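{- Let $\Gamma$ be a weighted digraph with Kirchhoff matrix $L$ and out forest dimension $v$, and let $\sigma_k$ be the total weight of all out forests of $\Gamma$ with $k$ arcs. Then $$p'_L(\lambda)=\lambda\sum_{i=0}^{n-v}\sigma_{n-v-i}\,(-\lambda)^{i}$$ is an annihilating polynomial for $L$, i.e. $p'_L(L)=0$.
   Context: $\Gamma$ is a weighted digraph without loops with vertex set $\{1,\dots,n\}$, $n>1$; all arcs have strictly positive real weights; $\varepsilon_{ij}$ denotes the weight of the arc from $i$ to $j$, with $\varepsilon_{ij}=0$ if and only if there is no such arc. The Kirchhoff matrix $L=(\ell_{ij})$ is the $n\times n$ matrix with $\ell_{ij}=-\varepsilon_{ji}$ for $j\ne i$ and $\ell_{ii}=-\sum_{k\ne i}\ell_{ik}$. A diverging forest is a digraph without (directed) circuits in which every vertex has indegree at most 1. An out forest of $\Gamma$ is a spanning subgraph of $\Gamma$ that is a diverging forest. The weight of a subgraph is the product of the weights of its arcs (1 if it has no arcs); the total weight of a set of subgraphs is the sum of the weights of its elements (0 for the empty set). The out forest dimension $v$ is the minimum number of weak components of an out forest of $\Gamma$, so the maximum number of arcs of an out forest is $n-v$. Here $p'_L$ is just the name of the polynomial (the prime does not denote a derivative). -}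

module Defs where

open import Level using (0ℓ; _⊔_)
open import Algebra.Bundles using (CommutativeRing)
open import Algebra.Structures using (IsCommutativeRing)
import Algebra.Properties.CommutativeMonoid.Sum as Sum
open import Data.Bool.Base using (if_then_else_)
open import Data.Fin.Base using (Fin)
open import Data.Fin.Properties using (_≟_; all?)
open import Data.Fin.Subset using (Subset; inside; outside; _∈_)
open import Data.Fin.Subset.Properties using (_∈?_)
open import Data.List.Base
  using (List; []; _∷_; [_]; map; filter; foldr; length; upTo; allFin; cartesianProduct; cartesianProductWith)
open import Data.List.Membership.Propositional using () renaming (_∈_ to _∈ˡ_)
open import Data.List.Membership.Propositional.Properties using (∈-allFin)
open import Data.List.Relation.Unary.Any using (here; there)
open import Data.Nat.Base as ℕ using (ℕ; zero; suc)
import Data.Nat.Properties as ℕ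
open import Data.Product.Base using (∃; _×_; _,_; proj₁; proj₂)
open import Data.Rational.Base as ℚ using (ℚ; 0ℚ; 1ℚ; ½)
import Data.Rational.Properties as ℚ
open import Data.Rational.Solver using (module +-*-Solver)
open import Data.Sum.Base using (_⊎_; inj₁; inj₂)
open import Data.Vec.Base as Vec using (Vec; lookup)
open import Function.Bundles using (_⇔_)
open import Function.Definitions using (Surjective)
open import Relation.Binary.Construct.Closure.Equivalence using (EqClosure)
open import Relation.Binary.Construct.Closure.Transitive as Trans using (TransClosure; _∷_)
  renaming ([_] to [_]⁺)
open import Relation.Binary.Core using (Rel)
open import Relation.Binary.Definitions using (Decidable)
open import Relation.Binary.PropositionalEquality
  using (_≡_; refl; sym; trans; cong; subst; subst₂)
open import Relation.Nullary.Decidable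
  using (Dec; does; map′; ¬?; _×-dec_; _⊎-dec_; _→-dec_)
open import Relation.Nullary.Negation using (¬_)

-- Real numbers, as Cauchy sequences of rationals modulo null sequences

Close : ℚ → ℚ → ℚ → Set
Close ε p q = ℚ.∣ p ℚ.- q ∣ ℚ.< ε

record ℝ : Set where
  constructor mkℝ
  field
    seq    : ℕ → ℚ
    cauchy : ∀ ε → 0ℚ ℚ.< ε →
             ∃ λ N → ∀ m n → N ℕ.≤ m → N ℕ.≤ n → Close ε (seq m) (seq n)

open ℝ

infix 4 _≈ℝ_

_≈ℝ_ : Rel ℝ 0ℓ
x ≈ℝ y = ∀ ε → 0ℚ ℚ.< ε →
         ∃ λ N → ∀ n → N ℕ.≤ n → Close ε (seq x n) (seq y n)

Positiveℝ : ℝ → Set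
Positiveℝ x = ∃ λ ε → 0ℚ ℚ.< ε × ∃ λ N → ∀ n → N ℕ.≤ n → ε ℚ.≤ seq x n

private
  ½+½ : ∀ ε → ½ ℚ.* ε ℚ.+ ½ ℚ.* ε ≡ ε
  ½+½ ε = trans (sym (ℚ.*-distribʳ-+ ε ½ ½)) (ℚ.*-identityˡ ε)

  *-pos : ∀ {p q} → 0ℚ ℚ.< p → 0ℚ ℚ.< q → 0ℚ ℚ.< p ℚ.* q
  *-pos {p} {q} 0<p 0<q = ℚ.positive⁻¹ (p ℚ.* q)
    {{ℚ.pos*pos⇒pos p {{ℚ.positive 0<p}} q {{ℚ.positive 0<q}}}}

  half-pos : ∀ {ε} → 0ℚ ℚ.< ε → 0ℚ ℚ.< ½ ℚ.* ε
  half-pos = *-pos (ℚ.positive⁻¹ ½)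

  close-refl : ∀ {ε p q} → 0ℚ ℚ.< ε → p ≡ q → Close ε p q
  close-refl {ε} {p} 0<ε refl =
    subst (ℚ._< ε) (sym (cong ℚ.∣_∣ (ℚ.+-inverseʳ p))) 0<ε

  close-sym : ∀ {ε p q} → Close ε p q → Close ε q p
  close-sym {ε} {p} {q} = subst (ℚ._< ε) (trans (sym (ℚ.∣-p∣≡∣p∣ (p ℚ.- q)))
    (cong ℚ.∣_∣ (solve 2 (λ p q → :- (p :- q) := q :- p) refl p q)))
    where open +-*-Solver

  close-half : ∀ {ε p q r s t u} → Close (½ ℚ.* ε) p q → Close (½ ℚ.* ε) r s →
               t ℚ.- u ≡ (p ℚ.- q) ℚ.+ (r ℚ.- s) → Close ε t u
  close-half {ε} {p} {q} {r} {s} c d e =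
    subst₂ ℚ._<_ (cong ℚ.∣_∣ (sym e)) (½+½ ε)
      (ℚ.≤-<-trans (ℚ.∣p+q∣≤∣p∣+∣q∣ (p ℚ.- q) (r ℚ.- s)) (ℚ.+-mono-< c d))

  close-trans : ∀ {ε p q r} → Close (½ ℚ.* ε) p q → Close (½ ℚ.* ε) q r → Close ε p r
  close-trans {ε} {p} {q} {r} c d = close-half {ε} {p} {q} {q} {r} {p} {r} c d
    (solve 3 (λ p q r → p :- r := (p :- q) :+ (q :- r)) refl p q r)
    where open +-*-Solver

  close-+ : ∀ {ε p p′ q q′} → Close (½ ℚ.* ε) p p′ → Close (½ ℚ.* ε) q q′ →
            Close ε (p ℚ.+ q) (p′ ℚ.+ q′)
  close-+ {ε} {p} {p′} {q} {q′} c d = close-half {ε} {p} {p′} {q} {q′} {p ℚ.+ q} {p′ ℚ.+ q′} c d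
    (solve 4 (λ p p′ q q′ → (p :+ q) :- (p′ :+ q′) := (p :- p′) :+ (q :- q′))
      refl p p′ q q′)
    where open +-*-Solver

  close-neg : ∀ {ε p q} → Close ε p q → Close ε (ℚ.- p) (ℚ.- q)
  close-neg {ε} {p} {q} = subst (ℚ._< ε) (trans (sym (ℚ.∣-p∣≡∣p∣ (p ℚ.- q)))
    (cong ℚ.∣_∣ (solve 2 (λ p q → :- (p :- q) := (:- p) :- (:- q)) refl p q)))
    where open +-*-Solver

  scaled : ∀ B ε → 0ℚ ℚ.< B → 0ℚ ℚ.< ε → ∃ λ δ → 0ℚ ℚ.< δ × B ℚ.* δ ≡ ε
  scaled B ε 0<B 0<ε = B⁻¹ ℚ.* ε
    , *-pos (ℚ.positive⁻¹ B⁻¹ {{ℚ.1/pos⇒pos B}}) 0<ε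
    , trans (sym (ℚ.*-assoc B B⁻¹ ε))
        (trans (cong (ℚ._* ε) (ℚ.*-inverseʳ B)) (ℚ.*-identityˡ ε))
    where
    instance
      B-pos = ℚ.positive 0<B
      B-nonZero = ℚ.pos⇒nonZero B
    B⁻¹ = ℚ.1/ B

  close-* : ∀ {B δ ε p p′ q q′} → 0ℚ ℚ.< B → B ℚ.* δ ≡ ½ ℚ.* ε →
            ℚ.∣ p ∣ ℚ.≤ B → ℚ.∣ q′ ∣ ℚ.≤ B → Close δ p p′ → Close δ q q′ →
            Close ε (p ℚ.* q) (p′ ℚ.* q′)
  close-* {B} {δ} {ε} {p} {p′} {q} {q′} 0<B Bδ p≤B q′≤B c d =
    close-trans {ε} {p ℚ.* q} {p ℚ.* q′} {p′ ℚ.* q′}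
      (bound (solve 3 (λ p q q′ → (p :* q) :- (p :* q′) := p :* (q :- q′)) refl p q q′)
        p≤B d)
      (bound (solve 3 (λ p p′ q′ → (p :* q′) :- (p′ :* q′) := q′ :* (p :- p′)) refl p p′ q′)
        q′≤B c)
    where
    open +-*-Solver
    instance
      B-pos = ℚ.positive 0<B
    bound : ∀ {a b d} → a ≡ b ℚ.* d → ℚ.∣ b ∣ ℚ.≤ B → ℚ.∣ d ∣ ℚ.< δ →
            ℚ.∣ a ∣ ℚ.< ½ ℚ.* ε
    bound {a} {b} {d} e b≤B d<δ = subst₂ ℚ._<_
      (trans (sym (ℚ.∣p*q∣≡∣p∣*∣q∣ b d)) (cong ℚ.∣_∣ (sym e))) Bδ
      (ℚ.≤-<-trans
        (ℚ.*-monoʳ-≤-nonNeg ℚ.∣ d ∣ {{ℚ.nonNegative (ℚ.0≤∣p∣ d)}} b≤B)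
        (ℚ.*-monoʳ-<-pos B d<δ))

  Bound : ℝ → ℚ → ℕ → Set
  Bound x B N = ∀ n → N ℕ.≤ n → ℚ.∣ seq x n ∣ ℚ.≤ B

  bounded : ∀ x → ∃ λ B → 0ℚ ℚ.< B × ∃ (Bound x B)
  bounded x = ℚ.∣ s ∣ ℚ.+ 1ℚ
    , ℚ.+-mono-≤-< (ℚ.0≤∣p∣ s) (ℚ.positive⁻¹ 1ℚ)
    , N , λ n N≤n → subst (ℚ._≤ ℚ.∣ s ∣ ℚ.+ 1ℚ)
        (cong ℚ.∣_∣ (solve 2 (λ s t → s :+ (t :- s) := t) refl s (seq x n)))
        (ℚ.≤-trans (ℚ.∣p+q∣≤∣p∣+∣q∣ s (seq x n ℚ.- s))
          (ℚ.+-monoʳ-≤ ℚ.∣ s ∣ (ℚ.<⇒≤ (close n N N≤n ℕ.≤-refl))))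
    where
    open +-*-Solver
    N = proj₁ (cauchy x 1ℚ (ℚ.positive⁻¹ 1ℚ))
    close = proj₂ (cauchy x 1ℚ (ℚ.positive⁻¹ 1ℚ))
    s = seq x N

  commonBound : ∀ x y → ∃ λ B → 0ℚ ℚ.< B × ∃ λ N → Bound x B N × Bound y B N
  commonBound x y =
    let B , 0<B , M , bx = bounded x
        C , 0<C , N , by = bounded y in
    B ℚ.+ C
    , ℚ.+-mono-< 0<B 0<C
    , M ℕ.⊔ N
    , (λ n le → ℚ.≤-trans (bx n (ℕ.m⊔n≤o⇒m≤o M N le))
        (subst (ℚ._≤ B ℚ.+ C) (ℚ.+-identityʳ B) (ℚ.+-monoʳ-≤ B (ℚ.<⇒≤ 0<C))))
    , (λ n le → ℚ.≤-trans (by n (ℕ.m⊔n≤o⇒n≤o M N le))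
        (subst (ℚ._≤ B ℚ.+ C) (ℚ.+-identityˡ C) (ℚ.+-monoˡ-≤ C (ℚ.<⇒≤ 0<B))))

  maxˡ : ∀ {m n o} → m ℕ.⊔ n ℕ.≤ o → m ℕ.≤ o
  maxˡ {m} {n} = ℕ.m⊔n≤o⇒m≤o m n

  maxʳ : ∀ {m n o} → m ℕ.⊔ n ℕ.≤ o → n ℕ.≤ o
  maxʳ {m} {n} = ℕ.m⊔n≤o⇒n≤o m n

fromℚ : ℚ → ℝ
fromℚ q = mkℝ (λ _ → q) λ ε 0<ε → 0 , λ _ _ _ _ → close-refl {ε} {q} 0<ε refl

infixl 6 _+ℝ_
infixl 7 _*ℝ_
infix  8 -ℝ_

_+ℝ_ : ℝ → ℝ → ℝ
seq (x +ℝ y) n = seq x n ℚ.+ seq y n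
cauchy (x +ℝ y) ε 0<ε =
  let M , cx = cauchy x (½ ℚ.* ε) (half-pos 0<ε)
      N , cy = cauchy y (½ ℚ.* ε) (half-pos 0<ε) in
  M ℕ.⊔ N , λ m n le le′ →
  close-+ {ε} {seq x m} {seq x n} {seq y m} {seq y n}
    (cx m n (maxˡ le) (maxˡ le′)) (cy m n (maxʳ {M} le) (maxʳ {M} le′))

-ℝ_ : ℝ → ℝ
seq (-ℝ x) n = ℚ.- seq x n
cauchy (-ℝ x) ε 0<ε =
  let N , c = cauchy x ε 0<ε in
  N , λ m n le le′ → close-neg {ε} {seq x m} {seq x n} (c m n le le′)

_*ℝ_ : ℝ → ℝ → ℝ
seq (x *ℝ y) n = seq x n ℚ.* seq y n
cauchy (x *ℝ y) ε 0<ε =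
  let B , 0<B , K , bx , by = commonBound x y
      δ , 0<δ , Bδ = scaled B (½ ℚ.* ε) 0<B (half-pos 0<ε)
      M , cx = cauchy x δ 0<δ
      N , cy = cauchy y δ 0<δ in
  K ℕ.⊔ (M ℕ.⊔ N) , λ m n le le′ →
  close-* {B} {δ} {ε} {seq x m} {seq x n} {seq y m} {seq y n} 0<B Bδ
    (bx m (maxˡ le)) (by n (maxˡ le′))
    (cx m n (maxˡ (maxʳ {K} le)) (maxˡ (maxʳ {K} le′)))
    (cy m n (maxʳ {M} (maxʳ {K} le)) (maxʳ {M} (maxʳ {K} le′)))

private
  pointwise : ∀ {x y} → (∀ n → seq x n ≡ seq y n) → x ≈ℝ y
  pointwise {x} {y} eq ε 0<ε =
    0 , λ n _ → close-refl {ε} {seq x n} {seq y n} 0<ε (eq n)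

  +ℝ-cong : ∀ {x x′ y y′} → x ≈ℝ x′ → y ≈ℝ y′ → x +ℝ y ≈ℝ x′ +ℝ y′
  +ℝ-cong {x} {x′} {y} {y′} p q ε 0<ε =
    let M , c = p (½ ℚ.* ε) (half-pos 0<ε)
        N , d = q (½ ℚ.* ε) (half-pos 0<ε) in
    M ℕ.⊔ N , λ n le →
    close-+ {ε} {seq x n} {seq x′ n} {seq y n} {seq y′ n}
      (c n (maxˡ le)) (d n (maxʳ {M} le))

  -ℝ-cong : ∀ {x y} → x ≈ℝ y → -ℝ x ≈ℝ -ℝ y
  -ℝ-cong {x} {y} p ε 0<ε =
    let N , c = p ε 0<ε in
    N , λ n le → close-neg {ε} {seq x n} {seq y n} (c n le)

  *ℝ-cong : ∀ {x x′ y y′} → x ≈ℝ x′ → y ≈ℝ y′ → x *ℝ y ≈ℝ x′ *ℝ y′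
  *ℝ-cong {x} {x′} {y} {y′} p q ε 0<ε =
    let B , 0<B , K , bx , by = commonBound x y′
        δ , 0<δ , Bδ = scaled B (½ ℚ.* ε) 0<B (half-pos 0<ε)
        M , c = p δ 0<δ
        N , d = q δ 0<δ in
    K ℕ.⊔ (M ℕ.⊔ N) , λ n le →
    close-* {B} {δ} {ε} {seq x n} {seq x′ n} {seq y n} {seq y′ n} 0<B Bδ
      (bx n (maxˡ le)) (by n (maxˡ le))
      (c n (maxˡ (maxʳ {K} le))) (d n (maxʳ {M} (maxʳ {K} le)))

  ≈ℝ-trans : ∀ {x y z} → x ≈ℝ y → y ≈ℝ z → x ≈ℝ z
  ≈ℝ-trans {x} {y} {z} p q ε 0<ε =
    let M , c = p (½ ℚ.* ε) (half-pos 0<ε)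
        N , d = q (½ ℚ.* ε) (half-pos 0<ε) in
    M ℕ.⊔ N , λ n le →
    close-trans {ε} {seq x n} {seq y n} {seq z n} (c n (maxˡ le)) (d n (maxʳ {M} le))

  ≈ℝ-sym : ∀ {x y} → x ≈ℝ y → y ≈ℝ x
  ≈ℝ-sym {x} {y} p ε 0<ε =
    let N , c = p ε 0<ε in
    N , λ n le → close-sym {ε} {seq x n} {seq y n} (c n le)

+ℝ-*ℝ-isCommutativeRing :
  IsCommutativeRing _≈ℝ_ _+ℝ_ _*ℝ_ -ℝ_ (fromℚ 0ℚ) (fromℚ 1ℚ)
+ℝ-*ℝ-isCommutativeRing = record
  { isRing = record
    { +-isAbelianGroup = record
      { isGroup = record
        { isMonoid = record
          { isSemigroup = record
            { isMagma = record
              { isEquivalence = record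
                { refl  = λ {x} → pointwise {x} {x} λ _ → refl
                ; sym   = λ {x} {y} → ≈ℝ-sym {x} {y}
                ; trans = λ {x} {y} {z} → ≈ℝ-trans {x} {y} {z}
                }
              ; ∙-cong = λ {x} {x′} {y} {y′} → +ℝ-cong {x} {x′} {y} {y′}
              }
            ; assoc = λ x y z → pointwise {(x +ℝ y) +ℝ z} {x +ℝ (y +ℝ z)}
                λ n → ℚ.+-assoc (seq x n) (seq y n) (seq z n)
            }
          ; identity =
              (λ x → pointwise {fromℚ 0ℚ +ℝ x} {x} λ n → ℚ.+-identityˡ (seq x n))
            , (λ x → pointwise {x +ℝ fromℚ 0ℚ} {x} λ n → ℚ.+-identityʳ (seq x n))
          }
        ; inverse =
            (λ x → pointwise {(-ℝ x) +ℝ x} {fromℚ 0ℚ} λ n → ℚ.+-inverseˡ (seq x n))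
          , (λ x → pointwise {x +ℝ -ℝ x} {fromℚ 0ℚ} λ n → ℚ.+-inverseʳ (seq x n))
        ; ⁻¹-cong = λ {x} {y} → -ℝ-cong {x} {y}
        }
      ; comm = λ x y → pointwise {x +ℝ y} {y +ℝ x} λ n → ℚ.+-comm (seq x n) (seq y n)
      }
    ; *-cong = λ {x} {x′} {y} {y′} → *ℝ-cong {x} {x′} {y} {y′}
    ; *-assoc = λ x y z → pointwise {(x *ℝ y) *ℝ z} {x *ℝ (y *ℝ z)}
        λ n → ℚ.*-assoc (seq x n) (seq y n) (seq z n)
    ; *-identity =
        (λ x → pointwise {fromℚ 1ℚ *ℝ x} {x} λ n → ℚ.*-identityˡ (seq x n))
      , (λ x → pointwise {x *ℝ fromℚ 1ℚ} {x} λ n → ℚ.*-identityʳ (seq x n))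
    ; distrib =
        (λ x y z → pointwise {x *ℝ (y +ℝ z)} {x *ℝ y +ℝ x *ℝ z}
          λ n → ℚ.*-distribˡ-+ (seq x n) (seq y n) (seq z n))
      , (λ x y z → pointwise {(y +ℝ z) *ℝ x} {y *ℝ x +ℝ z *ℝ x}
          λ n → ℚ.*-distribʳ-+ (seq x n) (seq y n) (seq z n))
    }
  ; *-comm = λ x y → pointwise {x *ℝ y} {y *ℝ x} λ n → ℚ.*-comm (seq x n) (seq y n)
  }

ℝ-commutativeRing : CommutativeRing 0ℓ 0ℓ
ℝ-commutativeRing = record { isCommutativeRing = +ℝ-*ℝ-isCommutativeRing }

-- Row i is the set of heads of the arcs with tail i.
Digraph : ℕ → Set
Digraph n = Vec (Subset n) n

module _ {n : ℕ} where

  Arc : Digraph n → Rel (Fin n) 0ℓ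
  Arc D i j = j ∈ lookup D i

  arc? : ∀ D → Decidable (Arc D)
  arc? D i j = j ∈? lookup D i

  arcs : Digraph n → List (Fin n × Fin n)
  arcs D = filter (λ (i , j) → arc? D i j) (cartesianProduct (allFin n) (allFin n))

  size : Digraph n → ℕ
  size D = length (arcs D)

  indegree : Digraph n → Fin n → ℕ
  indegree D j = length (filter (λ i → arc? D i j) (allFin n))

  -- Every closed walk of positive length contains a circuit.
  Acyclic : Digraph n → Set
  Acyclic D = ∀ i → ¬ TransClosure (Arc D) i i

  DivergingForest : Digraph n → Set
  DivergingForest D = Acyclic D × (∀ j → indegree D j ℕ.≤ 1)

  SpanningSubgraph : Digraph n → Digraph n → Set
  SpanningSubgraph F D = ∀ i j → Arc F i j → Arc D i j

  OutForest : Digraph n → Digraph n → Set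
  OutForest D F = SpanningSubgraph F D × DivergingForest F

  -- D has exactly c weak components: its vertices can be labelled by all of
  -- Fin c so that two labels agree iff the vertices are weakly connected.
  HasWeakComponents : Digraph n → ℕ → Set
  HasWeakComponents D c = ∃ λ (label : Fin n → Fin c) →
    Surjective _≡_ _≡_ label ×
    (∀ i j → label i ≡ label j ⇔ EqClosure (Arc D) i j)

  record IsOutForestDimension (D : Digraph n) (v : ℕ) : Set where
    field
      attained : ∃ λ F → OutForest D F × HasWeakComponents F v
      minimal  : ∀ F c → OutForest D F → HasWeakComponents F c → v ℕ.≤ c

-- Reachability is decided by Warshall's algorithm.
module _ {n : ℕ} {R : Rel (Fin n) 0ℓ} (R? : Decidable R) where
  private
    Via : List (Fin n) → Rel (Fin n) 0ℓ
    Via []       i j = R i j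
    Via (k ∷ ks) i j = Via ks i j ⊎ (Via ks i k × Via ks k j)

    via? : ∀ ks → Decidable (Via ks)
    via? []       i j = R? i j
    via? (k ∷ ks) i j = via? ks i j ⊎-dec (via? ks i k ×-dec via? ks k j)

    sound : ∀ ks {i j} → Via ks i j → TransClosure R i j
    sound []       r              = [ r ]⁺
    sound (k ∷ ks) (inj₁ p)       = sound ks p
    sound (k ∷ ks) (inj₂ (p , q)) = sound ks p Trans.++ sound ks q

    base : ∀ ks {i j} → R i j → Via ks i j
    base []       r = r
    base (k ∷ ks) r = inj₁ (base ks r)

    join : ∀ ks {i m j} → m ∈ˡ ks → Via ks i m → Via ks m j → Via ks i j
    join (k ∷ ks) (here refl) p q = inj₂ (toHead p , fromHead q)
      where
      toHead : ∀ {i} → Via (k ∷ ks) i k → Via ks i k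
      toHead (inj₁ p)       = p
      toHead (inj₂ (p , _)) = p
      fromHead : ∀ {j} → Via (k ∷ ks) k j → Via ks k j
      fromHead (inj₁ q)       = q
      fromHead (inj₂ (_ , q)) = q
    join (k ∷ ks) (there m∈) (inj₁ p)       (inj₁ q)       = inj₁ (join ks m∈ p q)
    join (k ∷ ks) (there m∈) (inj₁ p)       (inj₂ (q , r)) = inj₂ (join ks m∈ p q , r)
    join (k ∷ ks) (there m∈) (inj₂ (p , q)) (inj₁ r)       = inj₂ (p , join ks m∈ q r)
    join (k ∷ ks) (there m∈) (inj₂ (p , _)) (inj₂ (_ , r)) = inj₂ (p , r)

    complete : ∀ {i j} → TransClosure R i j → Via (allFin n) i j
    complete [ r ]⁺  = base (allFin n) r
    complete (r ∷ p) = join (allFin n) (∈-allFin _) (base (allFin n) r) (complete p)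

  transClosure? : Decidable (TransClosure R)
  transClosure? i j = map′ (sound (allFin n)) complete (via? (allFin n) i j)

module _ {n : ℕ} where

  divergingForest? : (D : Digraph n) → Dec (DivergingForest D)
  divergingForest? D =
    all? (λ i → ¬? (transClosure? (arc? D) i i)) ×-dec
    all? (λ j → indegree D j ℕ.≤? 1)

  outForest? : (D F : Digraph n) → Dec (OutForest D F)
  outForest? D F =
    all? (λ i → all? λ j → arc? F i j →-dec arc? D i j) ×-dec divergingForest? F

allVecs : ∀ {a} {A : Set a} → List A → ∀ n → List (Vec A n)
allVecs xs zero    = [ Vec.[] ]
allVecs xs (suc n) = cartesianProductWith Vec._∷_ xs (allVecs xs n)

allDigraphs : ∀ n → List (Digraph n)
allDigraphs n = allVecs (allVecs (inside ∷ outside ∷ []) n) n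

outForests : ∀ {n} → Digraph n → ℕ → List (Digraph n)
outForests {n} D k =
  filter (λ F → outForest? D F ×-dec (size F ℕ.≟ k)) (allDigraphs n)

-- Positive stands for strict positivity; the module is opened at ℝ below.

module Weighted
  {c ℓ p} (R : CommutativeRing c ℓ) (Positive : CommutativeRing.Carrier R → Set p)
  where

  open CommutativeRing R
  open Sum +-commutativeMonoid using (sum)

  ∑ : ∀ {a} {A : Set a} → List A → (A → Carrier) → Carrier
  ∑ xs f = foldr _+_ 0# (map f xs)

  ∏ : ∀ {a} {A : Set a} → List A → (A → Carrier) → Carrier
  ∏ xs f = foldr _*_ 1# (map f xs)

  Matrix : ℕ → Set c
  Matrix n = Fin n → Fin n → Carrier

  module _ {n : ℕ} where

    infix  4 _≈ₘ_
    infixl 6 _+ₘ_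
    infixl 7 _*ₘ_

    _≈ₘ_ : Rel (Matrix n) ℓ
    A ≈ₘ B = ∀ i j → A i j ≈ B i j

    0ₘ : Matrix n
    0ₘ _ _ = 0#

    scalarₘ : Carrier → Matrix n
    scalarₘ a i j = if does (i ≟ j) then a else 0#

    _+ₘ_ : Matrix n → Matrix n → Matrix n
    (A +ₘ B) i j = A i j + B i j

    _*ₘ_ : Matrix n → Matrix n → Matrix n
    (A *ₘ B) i j = sum λ k → A i k * B k j

  -- Coefficients are listed from the constant term upwards.
  Polynomial : Set c
  Polynomial = List Carrier

  infixl 6 _+ₚ_
  infixl 7 _*ₚ_ _·ₚ_
  infix  8 -ₚ_
  infixr 9 _^ₚ_

  _+ₚ_ : Polynomial → Polynomial → Polynomial
  []      +ₚ q       = q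
  (a ∷ p) +ₚ []      = a ∷ p
  (a ∷ p) +ₚ (b ∷ q) = (a + b) ∷ (p +ₚ q)

  _·ₚ_ : Carrier → Polynomial → Polynomial
  a ·ₚ p = map (a *_) p

  -ₚ_ : Polynomial → Polynomial
  -ₚ p = map -_ p

  _*ₚ_ : Polynomial → Polynomial → Polynomial
  []      *ₚ q = []
  (a ∷ p) *ₚ q = (a ·ₚ q) +ₚ (0# ∷ (p *ₚ q))

  _^ₚ_ : Polynomial → ℕ → Polynomial
  p ^ₚ zero  = [ 1# ]
  p ^ₚ suc i = p *ₚ (p ^ₚ i)

  ∑ₚ : ∀ {a} {A : Set a} → List A → (A → Polynomial) → Polynomial
  ∑ₚ xs f = foldr _+ₚ_ [] (map f xs)

  indeterminate : Polynomial
  indeterminate = 0# ∷ 1# ∷ []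

  evaluate : ∀ {n} → Polynomial → Matrix n → Matrix n
  evaluate []      A = 0ₘ
  evaluate (a ∷ p) A = scalarₘ a +ₘ A *ₘ evaluate p A

  Annihilates : ∀ {n} → Polynomial → Matrix n → Set ℓ
  Annihilates p A = evaluate p A ≈ₘ 0ₘ

  record WeightedDigraph (n : ℕ) : Set (c ⊔ ℓ ⊔ p) where
    field
      digraph  : Digraph n
      loopless : ∀ i → ¬ Arc digraph i i
      ε        : Fin n → Fin n → Carrier
      ε-arc    : ∀ i j → Arc digraph i j → Positive (ε i j)
      ε-noArc  : ∀ i j → ¬ Arc digraph i j → ε i j ≈ 0#

  module _ {n : ℕ} (Γ : WeightedDigraph n) where
    open WeightedDigraph Γ

    kirchhoff : Matrix n
    kirchhoff i j =
      if does (i ≟ j)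
      then - ∑ (filter (λ k → ¬? (k ≟ i)) (allFin n)) (λ k → - ε k i)
      else - ε j i

    weight : Digraph n → Carrier
    weight F = ∏ (arcs F) λ (i , j) → ε i j

    totalWeight : List (Digraph n) → Carrier
    totalWeight Fs = ∑ Fs weight

    σ : ℕ → Carrier
    σ k = totalWeight (outForests digraph k)

    -- For the out forest dimension v we have v ≤ n, so ∸ does not truncate.
    p′ : ℕ → Polynomial
    p′ v = indeterminate *ₚ
      ∑ₚ (upTo (suc (n ℕ.∸ v)))
         (λ i → σ (n ℕ.∸ v ℕ.∸ i) ·ₚ ((-ₚ indeterminate) ^ₚ i))

open Weighted ℝ-commutativeRing Positiveℝ public

{-# OPTIONS --safe #-}
module Submission where

-- Let Q k i j be the total weight of the out forests with k arcs in which i lies in the tree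
-- rooted at j.  Then L (Q k) = σ (k+1) I − Q (k+1): split the out forests according to the arc
-- entering i.  If h is an out forest in which i is a root, then the arc m → i can be added to h
-- iff m is not in the tree of i, and adding it changes only the root of the vertices below i,
-- to that of m.  For fixed h all contributions cancel, the quadratic ones because replacing
-- the arc p → i by m → i is an involution that changes the sign.  Since Q 0 = σ 0 I, it follows
-- that Q k = Σᵢ σ (k−i) (−L)ⁱ.  A forest with k arcs has n − k weak components, so there is none
-- with n−v+1 arcs, and L (Q (n−v)) = 0.

open import Defs using
  ( Digraph; Arc; arc?; arcs; size; indegree; Acyclic; HasWeakComponents; IsOutForestDimension
  ; OutForest; outForest?; outForests; transClosure?; allVecs; allDigraphs; module Weighted )
open import Algebra.Bundles using (CommutativeMonoid; CommutativeRing)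
open import Data.Bool.Base using (true; false; if_then_else_)
open import Data.Bool.Properties using (if-not)
open import Data.Fin.Base using (Fin; zero; suc; punchIn)
open import Data.Fin.Induction using (spo-wellFounded)
open import Data.Fin.Properties using (_≟_; all?; any?; punchInᵢ≢i; ¬∀⟶∃¬)
open import Data.Fin.Subset using (inside; outside)
open import Data.Fin.Subset.Properties using (⊆-antisym)
open import Data.List.Base as List
  using (List; []; _∷_; _++_; map; filter; foldr; length; upTo; allFin; tabulate;
         cartesianProduct; cartesianProductWith)
open import Data.List.Membership.Propositional using () renaming (_∈_ to _∈ˡ_)
open import Data.List.Membership.Propositional.Properties
  using (∈-allFin; ∈-map⁺; ∈-map⁻; ∈-filter⁺; ∈-filter⁻; ∈-lookup; ∈-cartesianProductWith⁺)
open import Data.List.Membership.Propositional.Properties.WithK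
  using (unique∧set⇒bag; unique⇒irrelevant)
open import Data.List.Properties using (length-tabulate; map-tabulate; map-upTo; map-∘)
open import Data.List.Relation.Binary.BagAndSetEquality using (∼bag⇒↭)
open import Data.List.Relation.Binary.Permutation.Propositional as ↭ using (_↭_)
open import Data.List.Relation.Unary.All as All using ([]; _∷_)
open import Data.List.Relation.Unary.AllPairs using ([]; _∷_)
open import Data.List.Relation.Unary.Any as Any using (here; there)
open import Data.List.Relation.Unary.Any.Properties using (lookup-index)
open import Data.List.Relation.Unary.Unique.Propositional using (Unique)
open import Data.List.Relation.Unary.Unique.Propositional.Properties
  using (cartesianProductWith⁺; filter⁺; map⁺; allFin⁺)
open import Data.Maybe.Base using (Maybe; just; nothing)
open import Data.Maybe.Properties using (just-injective; ≡-dec)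
open import Data.Nat.Base as ℕ using (ℕ; zero; suc; z≤n; s≤s; _<_)
import Data.Nat.Properties as ℕ
open import Data.Product.Base using (∃; _×_; _,_; proj₁; proj₂; uncurry)
open import Data.Sum.Base using (_⊎_; inj₁; inj₂)
open import Data.Vec.Base as Vec using (Vec; lookup; insertAt; _[_]≔_)
open import Data.Vec.Properties
  using (lookup∘tabulate; lookup∘update; lookup∘update′; []=⇒lookup; lookup⇒[]=; ∷-injective;
         insertAt-lookup; []≔-idempotent; []≔-lookup)
open import Data.Vec.Relation.Binary.Pointwise.Extensional using (ext; Pointwise-≡⇒≡)
open import Function.Base using (_∘_; id; case_of_)
open import Function.Bundles using (_⇔_; mk⇔; Equivalence)
open import Function.Definitions using (Surjective)
open import Induction.WellFounded using (WellFounded; Acc; acc)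
open import Relation.Binary.Construct.Closure.Equivalence using (EqClosure; symmetric; transitive)
import Relation.Binary.Construct.Closure.ReflexiveTransitive as Star
open import Relation.Binary.Construct.Closure.Symmetric using (fwd; bwd)
open import Relation.Binary.Construct.Closure.Transitive as Trans using (TransClosure; _∷_)
  renaming ([_] to [_]⁺)
open import Relation.Binary.PropositionalEquality as ≡ using (_≡_; _≢_)
import Relation.Binary.Definitions as Binary
open import Relation.Nullary.Decidable
  using (Dec; does; yes; no; map′; ¬?; _×-dec_; _⊎-dec_; _→-dec_; dec-true; dec-false; does-⇔)
open import Relation.Nullary.Negation using (¬_; contradiction)
open import Relation.Unary using (Decidable)

-- The difficulty is to regroup sums over sets of forests without building bijections between those
-- sets. A forest is therefore stored as the vector of its parents, and every sum runs over all such
-- vectors: those that are not forests get weight 0 by definition, those using a missing arc because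
-- some factor `ε` is 0. Splitting by the arc entering `i` then means splitting by one coordinate; a
-- fibre consists of a vector `h` in which `i` is a root and its grafts, one for each possible
-- parent `p` of `i`. For a forest `h`, let `r m` tell whether the root of `m` in `h` is `j`, let
-- `δ = r i`, and let `e m` be `ε m i`, or 0 if `m` is in the tree of `i`. Up to the factor `w h`:
-- if `h` has `k` arcs, it contributes `Σ e m (δ − r m)` to `L (Q k)`, and its grafts contribute
-- `Σ e p (r p − δ)` to `Q (k+1) − σ (k+1) I`; if `h` has `k − 1` arcs, only its grafts count, and
-- they contribute the antisymmetric sum `ΣΣ e p e m (r p − r m)` to `L (Q k)`.

if-cong : ∀ {a} {A : Set a} {b c} {x y : A} → b ≡ c →
          (if b then x else y) ≡ (if c then x else y)
if-cong ≡.refl = ≡.refl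

-- Sums over lists in a commutative monoid, used for sums, products and counts alike.

module ListSum {c ℓ} (M : CommutativeMonoid c ℓ) where
  open CommutativeMonoid M
  open import Algebra.Properties.CommutativeMonoid.Sum M using (sum; sum-remove; sum-cong-≋)
  open import Algebra.Properties.CommutativeSemigroup commutativeSemigroup using (interchange; x∙yz≈y∙xz)
  open import Relation.Binary.Reasoning.Setoid setoid

  ∑ : ∀ {a} {A : Set a} → List A → (A → Carrier) → Carrier
  ∑ xs f = foldr _∙_ ε (map f xs)

  module _ {a} {A : Set a} where

    ∑-cong : ∀ (xs : List A) {f g : A → Carrier} → (∀ x → f x ≈ g x) → ∑ xs f ≈ ∑ xs g
    ∑-cong []       e = refl
    ∑-cong (x ∷ xs) e = ∙-cong (e x) (∑-cong xs e)

    ∑-ε : ∀ (xs : List A) → ∑ xs (λ _ → ε) ≈ ε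
    ∑-ε []       = refl
    ∑-ε (x ∷ xs) = trans (identityˡ _) (∑-ε xs)

    ∑-zero : ∀ (xs : List A) {f : A → Carrier} → (∀ x → f x ≈ ε) → ∑ xs f ≈ ε
    ∑-zero xs e = trans (∑-cong xs e) (∑-ε xs)

    ∑-∙ : ∀ (xs : List A) (f g : A → Carrier) → ∑ xs (λ x → f x ∙ g x) ≈ ∑ xs f ∙ ∑ xs g
    ∑-∙ []       f g = sym (identityˡ ε)
    ∑-∙ (x ∷ xs) f g = trans (∙-congˡ (∑-∙ xs f g)) (interchange _ _ _ _)

    ∑-++ : ∀ (xs ys : List A) (f : A → Carrier) → ∑ (xs ++ ys) f ≈ ∑ xs f ∙ ∑ ys f
    ∑-++ []       ys f = sym (identityˡ _)
    ∑-++ (x ∷ xs) ys f = trans (∙-congˡ (∑-++ xs ys f)) (sym (assoc _ _ _))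

    ∑-filter : ∀ {p} {P : A → Set p} (P? : Decidable P) (xs : List A) (f : A → Carrier) →
               ∑ (filter P? xs) f ≈ ∑ xs (λ x → if does (P? x) then f x else ε)
    ∑-filter P? []       f = refl
    ∑-filter P? (x ∷ xs) f with does (P? x)
    ... | true  = ∙-congˡ (∑-filter P? xs f)
    ... | false = trans (∑-filter P? xs f) (sym (identityˡ _))

    ∑-↭ : ∀ {xs ys : List A} (f : A → Carrier) → xs ↭ ys → ∑ xs f ≈ ∑ ys f
    ∑-↭ f ↭.refl          = refl
    ∑-↭ f (↭.prep x p)    = ∙-congˡ (∑-↭ f p)
    ∑-↭ f (↭.swap x y p)  =
      trans (∙-congˡ (∙-congˡ (∑-↭ f p))) (x∙yz≈y∙xz _ _ _)
    ∑-↭ f (↭.trans p q)   = trans (∑-↭ f p) (∑-↭ f q)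

  ∑-map : ∀ {a b} {A : Set a} {B : Set b} (g : A → B) (xs : List A) (f : B → Carrier) →
          ∑ (map g xs) f ≡ ∑ xs (f ∘ g)
  ∑-map g xs f = ≡.cong (foldr _∙_ ε) (≡.sym (map-∘ xs))

  ∑-comm : ∀ {a b} {A : Set a} {B : Set b} (xs : List A) (ys : List B) (f : A → B → Carrier) →
           ∑ xs (λ x → ∑ ys (f x)) ≈ ∑ ys (λ y → ∑ xs (λ x → f x y))
  ∑-comm []       ys f = sym (∑-ε ys)
  ∑-comm (x ∷ xs) ys f =
    trans (∙-congˡ (∑-comm xs ys f)) (sym (∑-∙ ys (f x) _))

  ∑-cartesianProductWith :
    ∀ {a b d} {A : Set a} {B : Set b} {D : Set d} (g : A → B → D) (xs : List A) (ys : List B)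
      (f : D → Carrier) →
    ∑ (cartesianProductWith g xs ys) f ≈ ∑ xs (λ x → ∑ ys (λ y → f (g x y)))
  ∑-cartesianProductWith g []       ys f = refl
  ∑-cartesianProductWith g (x ∷ xs) ys f = begin
    ∑ (map (g x) ys ++ cartesianProductWith g xs ys) f
      ≈⟨ ∑-++ (map (g x) ys) _ f ⟩
    ∑ (map (g x) ys) f ∙ ∑ (cartesianProductWith g xs ys) f
      ≈⟨ ∙-cong (reflexive (∑-map (g x) ys f)) (∑-cartesianProductWith g xs ys f) ⟩
    ∑ ys (f ∘ g x) ∙ ∑ xs (λ x → ∑ ys (λ y → f (g x y))) ∎

  sum≈∑ : ∀ {n} (t : Fin n → Carrier) → sum t ≈ ∑ (allFin n) t
  sum≈∑ {n} t = reflexive (≡.sym (≡.trans (≡.cong (foldr _∙_ ε) (map-tabulate id t)) (go t)))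
    where
    go : ∀ {n} (t : Fin n → Carrier) → foldr _∙_ ε (tabulate t) ≡ sum t
    go {zero}  t = ≡.refl
    go {suc n} t = ≡.cong (t zero ∙_) (go (t ∘ suc))

  -- Off `i` the two sums have the same terms, and at `i` the sum of `t` loses nothing. The
  -- condition on `t i` fits grafting: a root has no entering arc, so its entry is neutral.
  sum-update : ∀ {n} (i : Fin n) {t u : Fin n → Carrier} → t i ≈ ε → (∀ j → j ≢ i → t j ≈ u j) →
               sum u ≈ u i ∙ sum t
  sum-update {suc n} i {t} {u} tᵢ≈ε t≈u = begin
    sum u                                    ≈⟨ sum-remove {i = i} u ⟩
    u i ∙ sum (λ k → u (punchIn i k))
      ≈⟨ ∙-congˡ (sum-cong-≋ (λ k → sym (t≈u (punchIn i k) (punchInᵢ≢i i k)))) ⟩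
    u i ∙ sum (λ k → t (punchIn i k))        ≈⟨ ∙-congˡ (identityˡ _) ⟨
    u i ∙ (ε ∙ sum (λ k → t (punchIn i k)))  ≈⟨ ∙-congˡ (∙-congʳ tᵢ≈ε) ⟨
    u i ∙ (t i ∙ sum (λ k → t (punchIn i k))) ≈⟨ ∙-congˡ (sum-remove {i = i} t) ⟨
    u i ∙ sum t ∎

  ∑-update : ∀ {n} (i : Fin n) {t u : Fin n → Carrier} → t i ≈ ε → (∀ j → j ≢ i → t j ≈ u j) →
             ∑ (allFin n) u ≈ u i ∙ ∑ (allFin n) t
  ∑-update i {t} {u} e f = trans (sym (sum≈∑ u))
    (trans (sum-update i e f) (∙-congˡ (sum≈∑ t)))

  ∑-single : ∀ {n} (i : Fin n) {u : Fin n → Carrier} → (∀ j → j ≢ i → u j ≈ ε) →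
             ∑ (allFin n) u ≈ u i
  ∑-single {n} i e = trans
    (∑-update i (refl) (λ j j≢i → sym (e j j≢i)))
    (trans (∙-congˡ (∑-ε (allFin n))) (identityʳ _))

  ∑-extract : ∀ {n} (i : Fin n) (u : Fin n → Carrier) →
              ∑ (allFin n) u ≈ u i ∙ ∑ (allFin n) (λ j → if does (j ≟ i) then ε else u j)
  ∑-extract i u = ∑-update i
    (reflexive (if-cong (dec-true (i ≟ i) ≡.refl)))
    (λ j j≢i → reflexive (if-cong (dec-false (j ≟ i) j≢i)))

  -- Applied to parent vectors, the inner sum runs over one fibre: all vectors that agree outside
  -- `i`. This is the splitting by the arc entering `i`.
  ∑-allVecs : ∀ {a} {A : Set a} (xs : List A) {n} (i : Fin (suc n)) (f : Vec A (suc n) → Carrier) →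
              ∑ (allVecs xs (suc n)) f ≈ ∑ (allVecs xs n) (λ v → ∑ xs (λ x → f (insertAt v i x)))
  ∑-allVecs xs {n} zero f = trans
    (∑-cartesianProductWith Vec._∷_ xs (allVecs xs n) f) (∑-comm xs (allVecs xs n) _)
  ∑-allVecs xs {suc n} (suc i) f = begin
    ∑ (allVecs xs (suc (suc n))) f
      ≈⟨ ∑-cartesianProductWith Vec._∷_ xs (allVecs xs (suc n)) f ⟩
    ∑ xs (λ y → ∑ (allVecs xs (suc n)) (λ v → f (y Vec.∷ v)))
      ≈⟨ ∑-cong xs (λ y → ∑-allVecs xs i (λ v → f (y Vec.∷ v))) ⟩
    ∑ xs (λ y → ∑ (allVecs xs n) (λ v → ∑ xs (λ x → f (y Vec.∷ insertAt v i x))))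
      ≈⟨ ∑-cartesianProductWith Vec._∷_ xs (allVecs xs n) _ ⟨
    ∑ (allVecs xs (suc n)) (λ v → ∑ xs (λ x → f (insertAt v (suc i) x))) ∎

-- Forests as vectors of parents.

module Forests where
  open ≡ using (refl; sym; trans; cong; subst)

  -- An entry is the unique in-neighbour of its vertex, or nothing for a root.
  Parents : ℕ → Set
  Parents n = Vec (Maybe (Fin n)) n

  module _ {n : ℕ} where

    IsParent : Parents n → Fin n → Fin n → Set
    IsParent f i j = lookup f j ≡ just i

    isParent? : ∀ f → Binary.Decidable (IsParent f)
    isParent? f i j = ≡-dec _≟_ (lookup f j) (just i)

    -- A derivation is the entire upward path from a vertex, so it exists only if that path stops.
    -- This lets `Forest` express acyclicity without mentioning circuits, and gives induction along
    -- the path.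
    data Root (f : Parents n) : Fin n → Fin n → Set where
      here : ∀ {i} → lookup f i ≡ nothing → Root f i i
      up   : ∀ {i p r} → lookup f i ≡ just p → Root f p r → Root f i r

    root-nothing : ∀ {f i r} → Root f i r → lookup f r ≡ nothing
    root-nothing (here e) = e
    root-nothing (up _ ρ) = root-nothing ρ

    root-unique : ∀ {f i r s} → Root f i r → Root f i s → r ≡ s
    root-unique (here _) (here _)  = refl
    root-unique (here e) (up e′ _) = case trans (sym e) e′ of λ ()
    root-unique (up e _) (here e′) = case trans (sym e) e′ of λ ()
    root-unique (up e ρ) (up e′ τ) with refl ← just-injective (trans (sym e) e′) = root-unique ρ τ

    root-up⁻ : ∀ {f i p r} → lookup f i ≡ just p → Root f i r → Root f p r
    root-up⁻ e (here e′) = case trans (sym e) e′ of λ ()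
    root-up⁻ e (up e′ ρ) with refl ← just-injective (trans (sym e) e′) = ρ

    root-of-root : ∀ {f i r} → lookup f i ≡ nothing → Root f i r → i ≡ r
    root-of-root e ρ = root-unique (here e) ρ

    private
      -- Restates `Root` through a transitive closure, walked downward from the root, because that
      -- is decidable by `transClosure?`.
      Path : Parents n → Fin n → Fin n → Set
      Path f i r = lookup f r ≡ nothing × (i ≡ r ⊎ TransClosure (IsParent f) r i)

      path⇒root : ∀ {f i r} → Path f i r → Root f i r
      path⇒root {f} (e , inj₁ refl) = here e
      path⇒root {f} (e , inj₂ p)    = go p (here e)
        where
        go : ∀ {a b r} → TransClosure (IsParent f) a b → Root f a r → Root f b r
        go [ e ]⁺  ρ = up e ρ
        go (e ∷ p) ρ = go p (up e ρ)

      root⇒path : ∀ {f i r} → Root f i r → Path f i r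
      root⇒path (here e) = e , inj₁ refl
      root⇒path (up e ρ) with root⇒path ρ
      ... | e′ , inj₁ refl = e′ , inj₂ [ e ]⁺
      ... | e′ , inj₂ p    = e′ , inj₂ (p Trans.++ [ e ]⁺)

    -- Otherwise does (root? f i r) unfolds in goals and with-abstraction over root? misses it.
    abstract
      root? : ∀ f → Binary.Decidable (Root f)
      root? f i r = map′ path⇒root root⇒path
        (≡-dec _≟_ (lookup f r) nothing ×-dec (i ≟ r ⊎-dec transClosure? (isParent? f) r i))

    Forest : Parents n → Set
    Forest f = ∀ i → ∃ (Root f i)

    forest? : ∀ f → Dec (Forest f)
    forest? f = all? λ i → any? (root? f i)

    -- A closed walk at `i` enters `i` from its parent, so rotating it by one arc gives a closed
    -- walk at the parent. Climbing this way ends at a root, which no arc enters.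
    forest⇒acyclic : ∀ {f} → Forest f → ∀ i → ¬ TransClosure (IsParent f) i i
    forest⇒acyclic {f} F i p = go (proj₂ (F i)) p
      where
      last : ∀ {a b} → TransClosure (IsParent f) a b →
             ∃ λ q → IsParent f q b × (a ≡ q ⊎ TransClosure (IsParent f) a q)
      last [ e ]⁺ = _ , e , inj₁ refl
      last (e ∷ p) with last p
      ... | q , e′ , inj₁ refl = q , e′ , inj₂ [ e ]⁺
      ... | q , e′ , inj₂ p′   = q , e′ , inj₂ (e ∷ p′)
      go : ∀ {i r} → Root f i r → ¬ TransClosure (IsParent f) i i
      go (here e) p with last p
      ... | q , e′ , _ = case trans (sym e) e′ of λ ()
      go (up e ρ) p with last p
      ... | q , e′ , s with refl ← just-injective (trans (sym e) e′) with s
      ...   | inj₁ refl = go ρ [ e ]⁺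
      ...   | inj₂ p′   = go ρ (e ∷ p′)

    -- On a finite set the strict order "is an ancestor of" is well-founded, so climbing from `i`
    -- must stop.
    acyclic⇒forest : ∀ {f} → (∀ i → ¬ TransClosure (IsParent f) i i) → Forest f
    acyclic⇒forest {f} acyclic i = go i (wf i)
      where
      _⊏_ = TransClosure (IsParent f)
      wf : WellFounded _⊏_
      wf = spo-wellFounded {_⊏_ = _⊏_} record
        { isEquivalence = ≡.isEquivalence
        ; irrefl        = λ { refl → acyclic _ }
        ; trans         = Trans._++_
        ; <-resp-≈      = (λ { refl p → p }) , (λ { refl p → p })
        }
      go : ∀ i → Acc _⊏_ i → ∃ (Root f i)
      go i (acc rec) with lookup f i in e
      ... | nothing = i , here e
      ... | just p  with r , ρ ← go p (rec [ e ]⁺) = r , up e ρ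

    -- Grafting: a root `i` of `h` receives the parent `p`.

    module _ {h : Parents n} {i : Fin n} (hᵢ : lookup h i ≡ nothing) (p : Fin n) where

      private
        f : Parents n
        f = h [ i ]≔ just p

        fᵢ : lookup f i ≡ just p
        fᵢ = lookup∘update i h (just p)

        f≢ : ∀ {j} → j ≢ i → lookup f j ≡ lookup h j
        f≢ j≢i = lookup∘update′ j≢i h (just p)

        ≢i : ∀ {j q} → lookup h j ≡ just q → j ≢ i
        ≢i e refl = case trans (sym e) hᵢ of λ ()

      -- A path in `h` that meets the root `i` ends there. A path ending elsewhere avoids the only
      -- changed entry.
      graft-other : ∀ {m r} → Root h m r → r ≢ i → Root f m r
      graft-other (here e) r≢i = here (trans (f≢ r≢i) e)
      graft-other (up e ρ) r≢i = up (trans (f≢ (≢i e)) e) (graft-other ρ r≢i)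

      -- The old path up to `i` is continued by the new arc and then by the path of `p`, which
      -- avoids `i`.
      graft-below : ∀ {m r} → Root h m i → Root h p r → r ≢ i → Root f m r
      graft-below (here _) ρ r≢i = up fᵢ (graft-other ρ r≢i)
      graft-below (up e τ) ρ r≢i = up (trans (f≢ (≢i e)) e) (graft-below τ ρ r≢i)

      graft-forest : Forest h → ¬ Root h p i → Forest f
      graft-forest F ¬ρ m with F m | F p
      ... | r , τ | s , ρ with r ≟ i
      ...   | no r≢i   = r , graft-other τ r≢i
      ...   | yes refl = s , graft-below τ ρ λ { refl → ¬ρ ρ }

      -- The path in `f` is followed until it stops or first meets `i`, which is a root of `h`.
      prune-forest : Forest f → Forest h
      prune-forest F m = go (proj₂ (F m))
        where
        go : ∀ {m r} → Root f m r → ∃ (Root h m)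
        go {m} τ with m ≟ i
        ... | yes refl = i , here hᵢ
        go (here e) | no m≢i = _ , here (trans (sym (f≢ m≢i)) e)
        go (up e τ) | no m≢i with r , ρ ← go τ = r , up (trans (sym (f≢ m≢i)) e) ρ

      -- Climbing in `f` from the tree of `i` never leaves that tree: the new arc leads back into
      -- it. Yet its only root in `h` was `i`, which now has a parent, so the climb cannot stop.
      graft-cyclic : Root h p i → ¬ Forest f
      graft-cyclic ρ F = go (here hᵢ) (proj₂ (F i))
        where
        go : ∀ {m r} → Root h m i → ¬ Root f m r
        go {m} σ τ with m ≟ i
        go σ (here e) | yes refl = case trans (sym e) fᵢ of λ ()
        go σ (up e τ) | yes refl with refl ← just-injective (trans (sym e) fᵢ) = go ρ τ
        go σ (here e) | no m≢i = m≢i (root-of-root (trans (sym (f≢ m≢i)) e) σ)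
        go σ (up e τ) | no m≢i = go (root-up⁻ (trans (sym (f≢ m≢i)) e) σ) τ

  -- Vectors of parents and digraphs: enumerations and translation.

  allVecs-unique : ∀ {a} {A : Set a} {xs : List A} → Unique xs → ∀ n → Unique (allVecs xs n)
  allVecs-unique u zero    = [] ∷ []
  allVecs-unique u (suc n) = cartesianProductWith⁺ Vec._∷_ ∷-injective u (allVecs-unique u n)

  ∈-allVecs : ∀ {a} {A : Set a} {xs : List A} → (∀ x → x ∈ˡ xs) →
              ∀ {n} (v : Vec A n) → v ∈ˡ allVecs xs n
  ∈-allVecs full Vec.[]      = here refl
  ∈-allVecs full (x Vec.∷ v) = ∈-cartesianProductWith⁺ Vec._∷_ (full x) (∈-allVecs full v)

  maybes : ∀ n → List (Maybe (Fin n))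
  maybes n = nothing ∷ map just (allFin n)

  allParents : ∀ n → List (Parents n)
  allParents n = allVecs (maybes n) n

  ∈-allParents : ∀ {n} (f : Parents n) → f ∈ˡ allParents n
  ∈-allParents = ∈-allVecs λ where
    nothing  → here refl
    (just i) → there (∈-map⁺ just (∈-allFin i))

  allParents-unique : ∀ n → Unique (allParents n)
  allParents-unique n = allVecs-unique
    (All.tabulate (λ j∈ → case ∈-map⁻ just j∈ of λ { (_ , _ , refl) () })
      ∷ map⁺ just-injective (allFin⁺ n)) n

  ∈-allDigraphs : ∀ {n} (D : Digraph n) → D ∈ˡ allDigraphs n
  ∈-allDigraphs = ∈-allVecs (∈-allVecs λ where
    inside  → here refl
    outside → there (here refl))

  allDigraphs-unique : ∀ n → Unique (allDigraphs n)
  allDigraphs-unique n =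
    allVecs-unique (allVecs-unique (((λ ()) ∷ []) ∷ [] ∷ []) n) n

  -- With `short-constant`, this translates between indegree at most 1 and uniqueness of the
  -- in-neighbour.
  unique-constant : ∀ {a} {A : Set a} {xs : List A} → Unique xs →
                    (∀ {x y} → x ∈ˡ xs → y ∈ˡ xs → x ≡ y) → length xs ℕ.≤ 1
  unique-constant {xs = []}         u c = z≤n
  unique-constant {xs = x ∷ []}     u c = s≤s z≤n
  unique-constant {xs = x ∷ y ∷ xs} ((x≢y ∷ _) ∷ _) c =
    contradiction (c (here refl) (there (here refl))) x≢y

  short-constant : ∀ {a} {A : Set a} {xs : List A} → length xs ℕ.≤ 1 →
                   ∀ {x y} → x ∈ˡ xs → y ∈ˡ xs → x ≡ y
  short-constant {xs = _ ∷ []} _ (here refl) (here refl) = refl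
  short-constant {xs = _ ∷ _ ∷ _} (s≤s ()) _ _

  module _ {n : ℕ} where

    digraph-ext : {D E : Digraph n} → (∀ i j → Arc D i j ⇔ Arc E i j) → D ≡ E
    digraph-ext e = Pointwise-≡⇒≡ (ext λ i →
      ⊆-antisym (λ {j} → Equivalence.to (e i j)) (λ {j} → Equivalence.from (e i j)))

    graph : Parents n → Digraph n
    graph f = Vec.tabulate λ i → Vec.tabulate λ j → does (isParent? f i j)

    arc⇔parent : ∀ f i j → Arc (graph f) i j ⇔ IsParent f i j
    arc⇔parent f i j = mk⇔ to from
      where
      entry : lookup (lookup (graph f) i) j ≡ does (isParent? f i j)
      entry = trans (cong (λ v → lookup v j) (lookup∘tabulate _ i)) (lookup∘tabulate _ j)
      to : Arc (graph f) i j → IsParent f i j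
      to a with isParent? f i j | trans (sym entry) ([]=⇒lookup a)
      ... | yes p | _ = p
      from : IsParent f i j → Arc (graph f) i j
      from p = lookup⇒[]= j _ (trans entry (dec-true (isParent? f i j) p))

    private
      to   = λ {f} {i} {j} → Equivalence.to (arc⇔parent f i j)
      from = λ {f} {i} {j} → Equivalence.from (arc⇔parent f i j)

    graph-injective : ∀ {f g} → graph f ≡ graph g → f ≡ g
    graph-injective {f} {g} e = Pointwise-≡⇒≡ (ext go)
      where
      go : ∀ j → lookup f j ≡ lookup g j
      go j with lookup f j in ef | lookup g j in eg
      ... | nothing | nothing = refl
      ... | just i  | _       = sym (trans (sym eg) (to {g} (subst (λ D → Arc D i j) e (from {f} ef))))
      ... | nothing | just i  =
        trans (sym ef) (to {f} (subst (λ D → Arc D i j) (sym e) (from {g} eg)))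

    indegree-graph : ∀ f j → indegree (graph f) j ℕ.≤ 1
    indegree-graph f j = unique-constant (filter⁺ in? (allFin⁺ n)) λ x∈ y∈ →
      just-injective (trans (sym (parent x∈)) (parent y∈))
      where
      in? = λ i → arc? (graph f) i j
      parent : ∀ {i} → i ∈ˡ filter in? (allFin n) → IsParent f i j
      parent i∈ = to {f} (proj₂ (∈-filter⁻ in? {xs = allFin n} i∈))

    module _ (D : Digraph n) where

      private
        parentOf : ∀ j → Dec (∃ λ i → Arc D i j) → Maybe (Fin n)
        parentOf j (yes (i , _)) = just i
        parentOf j (no _)        = nothing

      parentsOf : Parents n
      parentsOf = Vec.tabulate λ j → parentOf j (any? λ i → arc? D i j)

      -- `parentsOf` keeps one in-neighbour of each vertex that has any; the bound on the indegree
      -- says that no arc is lost.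
      graph-parentsOf : (∀ j → indegree D j ℕ.≤ 1) → D ≡ graph parentsOf
      graph-parentsOf indegree≤1 =
        digraph-ext λ i j → mk⇔ (from {parentsOf} ∘ arc⇒parent i j) (parent⇒arc i j ∘ to {parentsOf})
        where
        arc⇒parent : ∀ i j → Arc D i j → IsParent parentsOf i j
        arc⇒parent i j a = trans (lookup∘tabulate _ j) (go (any? λ i → arc? D i j))
          where
          go : ∀ d → parentOf j d ≡ just i
          go (no ¬a)        = contradiction (i , a) ¬a
          go (yes (i′ , b)) = cong just (short-constant (indegree≤1 j)
            (∈-filter⁺ (λ i → arc? D i j) (∈-allFin i′) b)
            (∈-filter⁺ (λ i → arc? D i j) (∈-allFin i) a))
        parent⇒arc : ∀ i j → IsParent parentsOf i j → Arc D i j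
        parent⇒arc i j e = go (any? λ i → arc? D i j) (trans (sym (lookup∘tabulate _ j)) e)
          where
          go : ∀ d → parentOf j d ≡ just i → Arc D i j
          go (yes (_ , a)) refl = a

    acyclic-graph⇔forest : ∀ f → Acyclic (graph f) ⇔ Forest f
    acyclic-graph⇔forest f = mk⇔
      (λ acyclic → acyclic⇒forest λ i p → acyclic i (map⁺ᵗ (from {f}) p))
      (λ F i p → forest⇒acyclic F i (map⁺ᵗ (to {f}) p))
      where
      map⁺ᵗ : ∀ {R S : Fin n → Fin n → Set} → (∀ {i j} → R i j → S i j) →
              ∀ {i j} → TransClosure R i j → TransClosure S i j
      map⁺ᵗ f [ r ]⁺  = [ f r ]⁺
      map⁺ᵗ f (r ∷ p) = f r ∷ map⁺ᵗ f p

    Supported : Digraph n → Parents n → Set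
    Supported D f = ∀ i j → IsParent f i j → Arc D i j

    supported? : ∀ D → Decidable (Supported D)
    supported? D f = all? λ i → all? λ j → isParent? f i j →-dec arc? D i j

    outForest-graph : ∀ {D f} → Supported D f → Forest f → OutForest D (graph f)
    outForest-graph {D} {f} s F =
      (λ i j a → s i j (to {f} a)) , Equivalence.from (acyclic-graph⇔forest f) F , indegree-graph f

  -- Totals over the arcs of a forest: weights in one monoid, arc counts in another.

  module Total {c ℓ} (M : CommutativeMonoid c ℓ) where
    open CommutativeMonoid M
      renaming (refl to ≈-refl; trans to ≈-trans; sym to ≈-sym; reflexive to ≈-reflexive)
    open ListSum M
    open import Relation.Binary.Reasoning.Setoid setoid

    module _ {n : ℕ} (w : Fin n → Fin n → Carrier) where

      entry : Maybe (Fin n) → Fin n → Carrier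
      entry (just i) j = w i j
      entry nothing  j = ε

      total : Parents n → Carrier
      total f = ∑ (allFin n) λ j → entry (lookup f j) j

      -- Summing over heads outside and tails inside, the inner sum has at most one term that is not
      -- neutral, the one at the parent.
      ∑-arcs : ∀ f → ∑ (arcs (graph f)) (uncurry w) ≈ total f
      ∑-arcs f = begin
        ∑ (arcs (graph f)) (uncurry w)
          ≈⟨ ∑-filter (λ (i , j) → arc? (graph f) i j) (cartesianProduct (allFin n) (allFin n)) _ ⟩
        ∑ (cartesianProduct (allFin n) (allFin n))
          (λ (i , j) → if does (arc? (graph f) i j) then w i j else ε)
          ≈⟨ ∑-cartesianProductWith _,_ (allFin n) (allFin n) _ ⟩
        ∑ (allFin n) (λ i → ∑ (allFin n) (λ j → if does (arc? (graph f) i j) then w i j else ε))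
          ≈⟨ ∑-cong (allFin n) (λ i → ∑-cong (allFin n) (λ j → ≈-reflexive (if-cong
               (does-⇔ (arc⇔parent f i j) (arc? (graph f) i j) (isParent? f i j))))) ⟩
        ∑ (allFin n) (λ i → ∑ (allFin n) (λ j → if does (isParent? f i j) then w i j else ε))
          ≈⟨ ∑-comm (allFin n) (allFin n) _ ⟩
        ∑ (allFin n) (λ j → ∑ (allFin n) (λ i → if does (isParent? f i j) then w i j else ε))
          ≈⟨ ∑-cong (allFin n) column ⟩
        total f ∎
        where
        column : ∀ j → ∑ (allFin n) (λ i → if does (isParent? f i j) then w i j else ε) ≈
                       entry (lookup f j) j
        column j with lookup f j
        ... | nothing = ∑-ε (allFin n)
        ... | just p  = ≈-trans
          (∑-single p λ i i≢p → ≈-reflexive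
            (if-cong (dec-false (≡-dec _≟_ (just p) (just i)) λ { refl → i≢p refl })))
          (≈-reflexive (if-cong (dec-true (≡-dec _≟_ (just p) (just p)) refl)))

      total-graft : ∀ {h i} → lookup h i ≡ nothing → ∀ p →
                    total (h [ i ]≔ just p) ≈ w p i ∙ total h
      total-graft {h} {i} hᵢ p = begin
        total (h [ i ]≔ just p)
          ≈⟨ ∑-update i (≈-reflexive (cong (λ x → entry x i) hᵢ))
               (λ j j≢i → ≈-reflexive (cong (λ x → entry x j) (sym (lookup∘update′ j≢i h (just p))))) ⟩
        entry (lookup (h [ i ]≔ just p) i) i ∙ total h
          ≡⟨ cong (λ x → entry x i ∙ total h) (lookup∘update i h (just p)) ⟩
        w p i ∙ total h ∎

  open Total ℕ.+-0-commutativeMonoid using () renaming (total to totalℕ; ∑-arcs to sum-arcs)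

  count : ∀ {n} → Parents n → ℕ
  count = totalℕ λ _ _ → 1

  count-graft : ∀ {n} {h : Parents n} {i} → lookup h i ≡ nothing → ∀ p →
                count (h [ i ]≔ just p) ≡ suc (count h)
  count-graft {h = h} {i} = Total.total-graft ℕ.+-0-commutativeMonoid (λ _ _ → 1) {h} {i}

  length-sum : ∀ {a} {A : Set a} (xs : List A) →
               length xs ≡ ListSum.∑ ℕ.+-0-commutativeMonoid xs (λ _ → 1)
  length-sum []       = refl
  length-sum (x ∷ xs) = cong suc (length-sum xs)

  size-graph : ∀ {n} (f : Parents n) → size (graph f) ≡ count f
  size-graph f = trans (length-sum (arcs (graph f))) (sum-arcs (λ _ _ → 1) f)

  module _ {n : ℕ} (D : Digraph n) (k : ℕ) where

    outForestParents? : Decidable λ f → Supported D f × Forest f × count f ≡ k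
    outForestParents? f = supported? D f ×-dec forest? f ×-dec (count f ℕ.≟ k)

    -- Both lists are free of duplicates and have the same members, since each out forest is the
    -- graph of exactly one vector of parents.
    outForests↭ : outForests D k ↭ map graph (filter outForestParents? (allParents n))
    outForests↭ = ∼bag⇒↭ (unique∧set⇒bag
      (filter⁺ _ (allDigraphs-unique n))
      (map⁺ graph-injective (filter⁺ outForestParents? (allParents-unique n)))
      (mk⇔ to from))
      where
      P? = λ F → outForest? D F ×-dec (size F ℕ.≟ k)
      to : ∀ {F} → F ∈ˡ outForests D k → F ∈ˡ map graph (filter outForestParents? (allParents n))
      to {F} F∈ with ∈-filter⁻ P? {xs = allDigraphs n} F∈
      ... | _ , (sub , acyclic , deg) , refl with parentsOf F | graph-parentsOf F deg
      ...   | f | refl = ∈-map⁺ graph (∈-filter⁺ outForestParents? (∈-allParents f)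
        ( (λ i j e → sub i j (Equivalence.from (arc⇔parent f i j) e))
        , Equivalence.to (acyclic-graph⇔forest f) acyclic
        , sym (size-graph f)))
      from : ∀ {F} → F ∈ˡ map graph (filter outForestParents? (allParents n)) → F ∈ˡ outForests D k
      from F∈ with f , f∈ , refl ← ∈-map⁻ graph F∈
              with _ , s , F , refl ← ∈-filter⁻ outForestParents? {xs = allParents n} f∈ =
        ∈-filter⁺ P? (∈-allDigraphs (graph f)) (outForest-graph {D = D} s F , size-graph f)

  -- Weak components of a forest correspond to its roots.

  module _ {n : ℕ} (f : Parents n) where

    isRoot? : Decidable λ r → lookup f r ≡ nothing
    isRoot? r = ≡-dec _≟_ (lookup f r) nothing

    roots : List (Fin n)
    roots = filter isRoot? (allFin n)

    -- Each vertex contributes exactly 1: as a root, or through the single arc entering it.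
    length-roots : length roots ℕ.+ count f ≡ n
    length-roots = begin
      length roots ℕ.+ count f
        ≡⟨ cong (ℕ._+ count f) (trans (length-sum roots) (∑-filter isRoot? (allFin n) (λ _ → 1))) ⟩
      ∑ (allFin n) (λ r → if does (isRoot? r) then 1 else 0) ℕ.+ count f
        ≡⟨ ∑-∙ (allFin n) _ _ ⟨
      ∑ (allFin n) (λ r → (if does (isRoot? r) then 1 else 0) ℕ.+ entry (λ _ _ → 1) (lookup f r) r)
        ≡⟨ ∑-cong (allFin n) one ⟩
      ∑ (allFin n) (λ r → 1)
        ≡⟨ length-sum (allFin n) ⟨
      length (allFin n)
        ≡⟨ length-tabulate id ⟩
      n ∎
      where
      open ListSum ℕ.+-0-commutativeMonoid
      open Total ℕ.+-0-commutativeMonoid using (entry)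
      open ≡.≡-Reasoning
      one : ∀ r → (if does (isRoot? r) then 1 else 0) ℕ.+ entry (λ _ _ → 1) (lookup f r) r ≡ 1
      one r with lookup f r
      ... | nothing = refl
      ... | just _  = refl

    module _ (F : Forest f) where

      private
        root : Fin n → Fin n
        root i = proj₁ (F i)

        root-Root : ∀ i → Root f i (root i)
        root-Root i = proj₂ (F i)

        root∈ : ∀ i → root i ∈ˡ roots
        root∈ i = ∈-filter⁺ isRoot? (∈-allFin (root i)) (root-nothing (root-Root i))

        -- A label is the position of a membership proof. As `roots` has no duplicates, all proofs
        -- for one vertex coincide, so the label depends only on the root.
        label : Fin n → Fin (length roots)
        label i = Any.index (root∈ i)

        label-root : ∀ i → List.lookup roots (label i) ≡ root i
        label-root i = sym (lookup-index (root∈ i))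

        index-∈-lookup : ∀ {a} {A : Set a} (xs : List A) c → Any.index (∈-lookup {xs = xs} c) ≡ c
        index-∈-lookup (x ∷ xs) zero    = refl
        index-∈-lookup (x ∷ xs) (suc c) = cong suc (index-∈-lookup xs c)

        label-surjective : Surjective _≡_ _≡_ label
        label-surjective c = i , λ { refl → go (root∈ i) (sym root-i) }
          where
          i = List.lookup roots c
          root-i : i ≡ root i
          root-i = root-of-root (proj₂ (∈-filter⁻ isRoot? {xs = allFin n} (∈-lookup c))) (root-Root i)
          go : ∀ {r} (r∈ : r ∈ˡ roots) → r ≡ i → Any.index r∈ ≡ c
          go r∈ refl = trans
            (cong Any.index (unique⇒irrelevant (filter⁺ isRoot? (allFin⁺ n)) r∈ (∈-lookup c)))
            (index-∈-lookup roots c)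

        _~_ = EqClosure (Arc (graph f))

        arc : ∀ {i j} → IsParent f i j → Arc (graph f) i j
        arc = Equivalence.from (arc⇔parent f _ _)

        root~ : ∀ {i r} → Root f i r → i ~ r
        root~ (here _) = Star.ε
        root~ (up e ρ) = bwd (arc e) Star.◅ root~ ρ

        root-arc : ∀ {i j} → Arc (graph f) i j → root i ≡ root j
        root-arc {i} {j} a =
          root-unique (root-Root i) (root-up⁻ (Equivalence.to (arc⇔parent f i j) a) (root-Root j))

        ~⇒root : ∀ {i j} → i ~ j → root i ≡ root j
        ~⇒root Star.ε           = refl
        ~⇒root (fwd a Star.◅ p) = trans (root-arc a) (~⇒root p)
        ~⇒root (bwd a Star.◅ p) = trans (sym (root-arc a)) (~⇒root p)

        root⇒label : ∀ {i j} → root i ≡ root j → label i ≡ label j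
        root⇒label {i} {j} e = go (root∈ i) (root∈ j) e
          where
          go : ∀ {r s} (r∈ : r ∈ˡ roots) (s∈ : s ∈ˡ roots) → r ≡ s → Any.index r∈ ≡ Any.index s∈
          go r∈ s∈ refl = cong Any.index (unique⇒irrelevant (filter⁺ isRoot? (allFin⁺ n)) r∈ s∈)

        label⇒~ : ∀ i j → label i ≡ label j → i ~ j
        label⇒~ i j e = transitive _ (root~ (root-Root i))
          (subst (_~ j) (trans (sym (label-root j)) (trans (cong (List.lookup roots) (sym e)) (label-root i)))
            (symmetric _ (root~ (root-Root j))))

      forest-components : HasWeakComponents (graph f) (length roots)
      forest-components = label , label-surjective , λ i j → mk⇔ (label⇒~ i j) (root⇒label ∘ ~⇒root)

  no-larger-forest : ∀ {n v} {D : Digraph n} → IsOutForestDimension D v →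
                     ∀ {f} → Supported D f → Forest f → count f ≢ suc (n ℕ.∸ v)
  no-larger-forest {n} {v} {D} dim {f} s F count≡ = ℕ.<-irrefl refl (begin-strict
    -- This inequality holds for truncated subtraction, whatever `v` is.
    n                                     ≤⟨ ℕ.m≤n+m∸n n v ⟩
    v ℕ.+ (n ℕ.∸ v)                       ≤⟨ ℕ.+-monoˡ-≤ (n ℕ.∸ v) v≤roots ⟩
    length (roots f) ℕ.+ (n ℕ.∸ v)        <⟨ ℕ.+-monoʳ-< (length (roots f)) ℕ.≤-refl ⟩
    length (roots f) ℕ.+ suc (n ℕ.∸ v)    ≡⟨ cong (length (roots f) ℕ.+_) count≡ ⟨
    length (roots f) ℕ.+ count f          ≡⟨ length-roots f ⟩
    n                                     ∎)
    where
    open IsOutForestDimension dim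
    open ℕ.≤-Reasoning
    v≤roots : v ℕ.≤ length (roots f)
    v≤roots = minimal (graph f) _ (outForest-graph {D = D} s F) (forest-components f F)

open Forests

-- Presents every member of a fibre as an update of one fixed member, the form to which the grafting
-- lemmas apply.
insertAt-just : ∀ {a} {A : Set a} {n} (v : Vec.Vec A n) (i : Fin (suc n)) (x y : A) →
                insertAt v i y ≡ insertAt v i x [ i ]≔ y
insertAt-just v           zero    x y = ≡.refl
insertAt-just (z Vec.∷ v) (suc i) x y = ≡.cong (z Vec.∷_) (insertAt-just v i x y)

-- Both indicators are decided by the common root. This compares vertices within a forest and also a
-- forest with its graft.
same-root : ∀ {n} {f g : Parents n} {x y r} → Root f x r → Root g y r →
            ∀ j → does (root? f x j) ≡ does (root? g y j)
same-root {f = f} {g} {x} {y} ρ τ j = does-⇔ (mk⇔ to from) (root? f x j) (root? g y j)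
  where
  to : Root f x j → Root g y j
  to ρ′ with ≡.refl ← root-unique ρ ρ′ = τ
  from : Root g y j → Root f x j
  from τ′ with ≡.refl ← root-unique τ τ′ = ρ

-- If `i` had a parent, clearing that entry and restoring it would present `f` as a graft, so its
-- count would be a successor.
count-zero : ∀ {n} (f : Parents n) → count f ≡ 0 → ∀ i → lookup f i ≡ nothing
count-zero f c i with lookup f i in e
... | nothing = ≡.refl
... | just p  = case ≡.trans (≡.sym c) (≡.trans (≡.cong count restored)
    (count-graft {h = f [ i ]≔ nothing} {i} (lookup∘update i f nothing) p)) of λ ()
  where
  restored : f ≡ f [ i ]≔ nothing [ i ]≔ just p
  restored = ≡.sym (≡.trans ([]≔-idempotent f i)
    (≡.trans (≡.cong (f [ i ]≔_) (≡.sym e)) ([]≔-lookup f i)))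

-- The algebra, over an arbitrary commutative ring.

module Annihilation
  {c ℓ p} (R : CommutativeRing c ℓ) (Positive : CommutativeRing.Carrier R → Set p)
  where

  open CommutativeRing R
  open Weighted R Positive hiding (∑; ∏)
  open ListSum +-commutativeMonoid
  open import Algebra.Properties.Ring ring
  open import Algebra.Properties.CommutativeSemigroup *-commutativeSemigroup using (x∙yz≈y∙xz)
  open import Algebra.Properties.CommutativeSemigroup +-commutativeSemigroup using (interchange)
  open import Relation.Binary.Reasoning.Setoid setoid

  ⟦_⟧ : ∀ {a} {A : Set a} → Dec A → Carrier
  ⟦ d ⟧ = if does d then 1# else 0#

  module _ {a} {A : Set a} where

    *-∑ : ∀ x (xs : List A) f → x * ∑ xs f ≈ ∑ xs (λ y → x * f y)
    *-∑ x []       f = zeroʳ x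
    *-∑ x (y ∷ xs) f = trans (distribˡ x _ _) (+-congˡ (*-∑ x xs f))

    ∑-* : ∀ x (xs : List A) f → ∑ xs f * x ≈ ∑ xs (λ y → f y * x)
    ∑-* x xs f = trans (*-comm _ x) (trans (*-∑ x xs f) (∑-cong xs (λ y → *-comm x _)))

    -∑ : ∀ (xs : List A) f → - ∑ xs f ≈ ∑ xs (λ x → - f x)
    -∑ []       f = -0#≈0#
    -∑ (x ∷ xs) f = trans (sym (-‿+-comm _ _)) (+-congˡ (-∑ xs f))

    ∑-sub : ∀ (xs : List A) f g → ∑ xs (λ x → f x - g x) ≈ ∑ xs f - ∑ xs g
    ∑-sub xs f g = trans (∑-∙ xs f _) (+-congˡ (sym (-∑ xs g)))

  *-sub : ∀ x y z → x * (y - z) ≈ x * y - x * z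
  *-sub x y z = trans (distribˡ x y (- z)) (+-congˡ (sym (-‿distribʳ-* x z)))

  sub-antisym : ∀ x y → (x - y) + (y - x) ≈ 0#
  sub-antisym x y = begin
    (x - y) + (y - x)       ≈⟨ +-congˡ (+-comm y (- x)) ⟩
    (x - y) + (- x + y)     ≈⟨ interchange x (- y) (- x) y ⟩
    (x - x) + (- y + y)     ≈⟨ +-cong (-‿inverseʳ x) (-‿inverseˡ y) ⟩
    0# + 0#                 ≈⟨ +-identityˡ 0# ⟩
    0# ∎

  -- Exchanging `x` and `y` alone would show only that twice the sum is 0, which does not suffice in
  -- an arbitrary ring. Expanding with `T` and `U` makes the sum literally `T * U - T * U`.
  ∑∑-antisym : ∀ {a} {A : Set a} (xs : List A) (e r : A → Carrier) →
               ∑ xs (λ x → e x * ∑ xs (λ y → e y * (r x - r y))) ≈ 0#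
  ∑∑-antisym xs e r = begin
    ∑ xs (λ x → e x * ∑ xs (λ y → e y * (r x - r y)))
      ≈⟨ ∑-cong xs (λ x → *-congˡ (inner x)) ⟩
    ∑ xs (λ x → e x * (T * r x - U))
      ≈⟨ ∑-cong xs (λ x → trans (*-sub _ _ _) (+-congʳ (x∙yz≈y∙xz _ T _))) ⟩
    ∑ xs (λ x → T * (e x * r x) - e x * U)
      ≈⟨ ∑-sub xs _ _ ⟩
    ∑ xs (λ x → T * (e x * r x)) - ∑ xs (λ x → e x * U)
      ≈⟨ +-cong (sym (*-∑ T xs _)) (-‿cong (sym (∑-* U xs e))) ⟩
    T * U - T * U
      ≈⟨ -‿inverseʳ _ ⟩
    0# ∎
    where
    T = ∑ xs e
    U = ∑ xs (λ y → e y * r y)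
    inner : ∀ x → ∑ xs (λ y → e y * (r x - r y)) ≈ T * r x - U
    inner x = trans (∑-cong xs (λ y → *-sub _ _ _))
      (trans (∑-sub xs _ _) (+-congʳ (sym (∑-* (r x) xs e))))

  scalar-⟦⟧ : ∀ {n} a (i j : Fin n) → scalarₘ a i j ≈ a * ⟦ i ≟ j ⟧
  scalar-⟦⟧ a i j with does (i ≟ j)
  ... | true  = sym (*-identityʳ a)
  ... | false = sym (zeroʳ a)

  -- Evaluation of polynomials at a matrix; coefficient lists may end in zeros, so identities are
  -- stated after evaluation.

  module _ {n : ℕ} (A : Matrix n) where

    *ₘ-∑ : ∀ B i j → (A *ₘ B) i j ≈ ∑ (allFin n) (λ k → A i k * B k j)
    *ₘ-∑ B i j = sum≈∑ {n} (λ k → A i k * B k j)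

    *ₘ-congˡ : ∀ {B C} → B ≈ₘ C → A *ₘ B ≈ₘ A *ₘ C
    *ₘ-congˡ {B} {C} e i j = trans (*ₘ-∑ B i j)
      (trans (∑-cong (allFin n) (λ k → *-congˡ (e k j))) (sym (*ₘ-∑ C i j)))

    *ₘ-linear : ∀ a B C i j →
                (A *ₘ (λ k l → a * B k l + C k l)) i j ≈ a * (A *ₘ B) i j + (A *ₘ C) i j
    *ₘ-linear a B C i j = begin
      (A *ₘ (λ k l → a * B k l + C k l)) i j
        ≈⟨ *ₘ-∑ (λ k l → a * B k l + C k l) i j ⟩
      ∑ (allFin n) (λ k → A i k * (a * B k j + C k j))
        ≈⟨ ∑-cong (allFin n) (λ k → trans (distribˡ _ _ _) (+-congʳ (x∙yz≈y∙xz _ a _))) ⟩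
      ∑ (allFin n) (λ k → a * (A i k * B k j) + A i k * C k j)
        ≈⟨ ∑-∙ (allFin n) _ _ ⟩
      ∑ (allFin n) (λ k → a * (A i k * B k j)) + ∑ (allFin n) (λ k → A i k * C k j)
        ≈⟨ +-cong (trans (sym (*-∑ a (allFin n) _)) (*-congˡ (sym (*ₘ-∑ B i j)))) (sym (*ₘ-∑ C i j)) ⟩
      a * (A *ₘ B) i j + (A *ₘ C) i j ∎

    *ₘ-zero : ∀ i j → (A *ₘ 0ₘ) i j ≈ 0#
    *ₘ-zero i j = trans (*ₘ-∑ 0ₘ i j) (∑-zero (allFin n) (λ k → zeroʳ _))

    evaluate-+ : ∀ p q i j → evaluate (p +ₚ q) A i j ≈ evaluate p A i j + evaluate q A i j
    evaluate-+ []      q       i j = sym (+-identityˡ _)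
    evaluate-+ (a ∷ p) []      i j = sym (+-identityʳ _)
    evaluate-+ (a ∷ p) (b ∷ q) i j = begin
      scalarₘ (a + b) i j + (A *ₘ evaluate (p +ₚ q) A) i j
        ≈⟨ +-cong scalar-+ product-+ ⟩
      (scalarₘ a i j + scalarₘ b i j) + ((A *ₘ evaluate p A) i j + (A *ₘ evaluate q A) i j)
        ≈⟨ interchange _ _ _ _ ⟩
      evaluate (a ∷ p) A i j + evaluate (b ∷ q) A i j ∎
      where
      scalar-+ : scalarₘ (a + b) i j ≈ scalarₘ a i j + scalarₘ b i j
      scalar-+ with does (i ≟ j)
      ... | true  = refl
      ... | false = sym (+-identityˡ 0#)
      product-+ : (A *ₘ evaluate (p +ₚ q) A) i j ≈ (A *ₘ evaluate p A) i j + (A *ₘ evaluate q A) i j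
      product-+ = trans
        (*ₘ-congˡ (λ k l → trans (evaluate-+ p q k l) (+-congʳ (sym (*-identityˡ _)))) i j)
        (trans (*ₘ-linear 1# (evaluate p A) (evaluate q A) i j) (+-congʳ (*-identityˡ _)))

    evaluate-· : ∀ a p i j → evaluate (a ·ₚ p) A i j ≈ a * evaluate p A i j
    evaluate-· a []      i j = sym (zeroʳ a)
    evaluate-· a (b ∷ p) i j = begin
      scalarₘ (a * b) i j + (A *ₘ evaluate (a ·ₚ p) A) i j
        ≈⟨ +-cong scalar-* product-* ⟩
      a * scalarₘ b i j + a * (A *ₘ evaluate p A) i j
        ≈⟨ distribˡ a _ _ ⟨
      a * evaluate (b ∷ p) A i j ∎
      where
      scalar-* : scalarₘ (a * b) i j ≈ a * scalarₘ b i j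
      scalar-* with does (i ≟ j)
      ... | true  = refl
      ... | false = sym (zeroʳ a)
      product-* : (A *ₘ evaluate (a ·ₚ p) A) i j ≈ a * (A *ₘ evaluate p A) i j
      product-* = trans
        (*ₘ-congˡ (λ k l → trans (evaluate-· a p k l) (sym (+-identityʳ _))) i j)
        (trans (*ₘ-linear a (evaluate p A) 0ₘ i j) (trans (+-congˡ (*ₘ-zero i j)) (+-identityʳ _)))

    evaluate-constant : ∀ a i j → evaluate (a ∷ []) A i j ≈ a * ⟦ i ≟ j ⟧
    evaluate-constant a i j =
      trans (+-congˡ (*ₘ-zero i j)) (trans (+-identityʳ _) (scalar-⟦⟧ a i j))

    evaluate-0∷ : ∀ p i j → evaluate (0# ∷ p) A i j ≈ (A *ₘ evaluate p A) i j
    evaluate-0∷ p i j =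
      trans (+-congʳ (trans (scalar-⟦⟧ 0# i j) (zeroˡ _))) (+-identityˡ _)

    evaluate-linear : ∀ a b q i j → evaluate ((a ∷ b ∷ []) *ₚ q) A i j ≈
                      a * evaluate q A i j + b * (A *ₘ evaluate q A) i j
    evaluate-linear a b q i j = begin
      evaluate ((a ·ₚ q) +ₚ (0# ∷ ((b ·ₚ q) +ₚ (0# ∷ [])))) A i j
        ≈⟨ evaluate-+ (a ·ₚ q) _ i j ⟩
      evaluate (a ·ₚ q) A i j + evaluate (0# ∷ ((b ·ₚ q) +ₚ (0# ∷ []))) A i j
        ≈⟨ +-cong (evaluate-· a q i j) (evaluate-0∷ ((b ·ₚ q) +ₚ (0# ∷ [])) i j) ⟩
      a * evaluate q A i j + (A *ₘ evaluate ((b ·ₚ q) +ₚ (0# ∷ [])) A) i j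
        ≈⟨ +-congˡ (*ₘ-congˡ (λ k l → trans (evaluate-+ (b ·ₚ q) _ k l)
             (+-cong (evaluate-· b q k l) (trans (evaluate-constant 0# k l) (zeroˡ _)))) i j) ⟩
      a * evaluate q A i j + (A *ₘ (λ k l → b * evaluate q A k l + 0#)) i j
        ≈⟨ +-congˡ (*ₘ-linear b (evaluate q A) 0ₘ i j) ⟩
      a * evaluate q A i j + (b * (A *ₘ evaluate q A) i j + (A *ₘ 0ₘ) i j)
        ≈⟨ +-congˡ (trans (+-congˡ (*ₘ-zero i j)) (+-identityʳ _)) ⟩
      a * evaluate q A i j + b * (A *ₘ evaluate q A) i j ∎

    evaluate-λ* : ∀ q i j → evaluate (indeterminate *ₚ q) A i j ≈ (A *ₘ evaluate q A) i j
    evaluate-λ* q i j = trans (evaluate-linear 0# 1# q i j)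
      (trans (+-cong (zeroˡ _) (*-identityˡ _)) (+-identityˡ _))

    evaluate--λ* : ∀ q i j →
                   evaluate ((-ₚ indeterminate) *ₚ q) A i j ≈ - (A *ₘ evaluate q A) i j
    evaluate--λ* q i j = trans (evaluate-linear (- 0#) (- 1#) q i j)
      (trans (+-cong (trans (*-congʳ -0#≈0#) (zeroˡ _)) (-1*x≈-x _)) (+-identityˡ _))

    -- One more factor `−λ` in every summand multiplies the value of the whole sum by `−A`, by
    -- linearity.
    evaluate-∑-λ* : ∀ {b} {B : Set b} (xs : List B) (a : B → Carrier) (q : B → Polynomial) i j →
      evaluate (∑ₚ xs (λ x → a x ·ₚ ((-ₚ indeterminate) *ₚ q x))) A i j ≈
      - (A *ₘ evaluate (∑ₚ xs (λ x → a x ·ₚ q x)) A) i j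
    evaluate-∑-λ* []       a q i j = sym (trans (-‿cong (*ₘ-zero i j)) -0#≈0#)
    evaluate-∑-λ* (x ∷ xs) a q i j = begin
      evaluate (a x ·ₚ ((-ₚ indeterminate) *ₚ q x) +ₚ shifted) A i j
        ≈⟨ evaluate-+ (a x ·ₚ ((-ₚ indeterminate) *ₚ q x)) shifted i j ⟩
      evaluate (a x ·ₚ ((-ₚ indeterminate) *ₚ q x)) A i j + evaluate shifted A i j
        ≈⟨ +-cong (trans (evaluate-· (a x) ((-ₚ indeterminate) *ₚ q x) i j)
             (trans (*-congˡ (evaluate--λ* (q x) i j)) (sym (-‿distribʳ-* (a x) _))))
             (evaluate-∑-λ* xs a q i j) ⟩
      - (a x * (A *ₘ evaluate (q x) A) i j) + - (A *ₘ evaluate rest A) i j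
        ≈⟨ -‿+-comm _ _ ⟩
      - (a x * (A *ₘ evaluate (q x) A) i j + (A *ₘ evaluate rest A) i j)
        ≈⟨ -‿cong (*ₘ-linear (a x) (evaluate (q x) A) (evaluate rest A) i j) ⟨
      - (A *ₘ (λ k l → a x * evaluate (q x) A k l + evaluate rest A k l)) i j
        ≈⟨ -‿cong (*ₘ-congˡ (λ k l → trans (evaluate-+ (a x ·ₚ q x) rest k l)
             (+-congʳ (evaluate-· (a x) (q x) k l))) i j) ⟨
      - (A *ₘ evaluate (a x ·ₚ q x +ₚ rest) A) i j ∎
      where
      rest    = ∑ₚ xs (λ x → a x ·ₚ q x)
      shifted = ∑ₚ xs (λ x → a x ·ₚ ((-ₚ indeterminate) *ₚ q x))

  -- The Kirchhoff matrix and the weights of forests.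

  module _ {n : ℕ} (Γ : WeightedDigraph n) where
    open WeightedDigraph Γ
    open Total *-commutativeMonoid using (entry) renaming (total to arcProduct)
    private
      module ∏ = ListSum *-commutativeMonoid
      L = kirchhoff Γ

    w : Parents n → Carrier
    w = arcProduct ε

    -- On the diagonal `ε i i` is added to complete the sum and subtracted again, so that all
    -- entries have one form.
    kirchhoff-entry : ∀ i m →
      L i m ≈ (if does (i ≟ m) then ∑ (allFin n) (λ k → ε k i) else 0#) - ε m i
    kirchhoff-entry i m with i ≟ m
    ... | no  _      = sym (+-identityˡ _)
    ... | yes ≡.refl = begin
      - ∑ (filter (λ k → ¬? (k ≟ i)) (allFin n)) (λ k → - ε k i)
        ≈⟨ -‿cong (-∑ (filter (λ k → ¬? (k ≟ i)) (allFin n)) (λ k → ε k i)) ⟨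
      - - ∑ (filter (λ k → ¬? (k ≟ i)) (allFin n)) (λ k → ε k i)
        ≈⟨ -‿involutive _ ⟩
      ∑ (filter (λ k → ¬? (k ≟ i)) (allFin n)) (λ k → ε k i)
        ≈⟨ ∑-filter (λ k → ¬? (k ≟ i)) (allFin n) (λ k → ε k i) ⟩
      ∑ (allFin n) (λ k → if does (¬? (k ≟ i)) then ε k i else 0#)
        ≈⟨ ∑-cong (allFin n) (λ k → reflexive (if-not (does (k ≟ i)))) ⟩
      ∑ (allFin n) (λ k → if does (k ≟ i) then 0# else ε k i)
        ≈⟨ xyx⁻¹≈y (ε i i) _ ⟨
      ε i i + ∑ (allFin n) (λ k → if does (k ≟ i) then 0# else ε k i) - ε i i
        ≈⟨ +-congʳ (∑-extract i (λ k → ε k i)) ⟨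
      ∑ (allFin n) (λ k → ε k i) - ε i i ∎

    -- Vanishing row sums make `L` a weighted difference operator. For `B = Q k` each difference
    -- compares `i` and `m` in the same forest and is 0 wherever they share a root.
    kirchhoff-product : ∀ (B : Matrix n) i j →
      (L *ₘ B) i j ≈ ∑ (allFin n) (λ m → ε m i * (B i j - B m j))
    kirchhoff-product B i j = begin
      (L *ₘ B) i j
        ≈⟨ *ₘ-∑ L B i j ⟩
      ∑ (allFin n) (λ m → L i m * B m j)
        ≈⟨ ∑-cong (allFin n) (λ m → trans (*-congʳ (kirchhoff-entry i m))
             (trans (distribʳ _ _ _) (+-congˡ (sym (-‿distribˡ-* _ _))))) ⟩
      ∑ (allFin n) (λ m → D m * B m j - ε m i * B m j)
        ≈⟨ ∑-sub (allFin n) _ _ ⟩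
      ∑ (allFin n) (λ m → D m * B m j) - ∑ (allFin n) (λ m → ε m i * B m j)
        ≈⟨ +-congʳ (trans (∑-single i off-diagonal) (*-congʳ diagonal)) ⟩
      ∑ (allFin n) (λ k → ε k i) * B i j - ∑ (allFin n) (λ m → ε m i * B m j)
        ≈⟨ +-congʳ (∑-* (B i j) (allFin n) _) ⟩
      ∑ (allFin n) (λ k → ε k i * B i j) - ∑ (allFin n) (λ m → ε m i * B m j)
        ≈⟨ ∑-sub (allFin n) _ _ ⟨
      ∑ (allFin n) (λ m → ε m i * B i j - ε m i * B m j)
        ≈⟨ ∑-cong (allFin n) (λ m → *-sub _ _ _) ⟨
      ∑ (allFin n) (λ m → ε m i * (B i j - B m j)) ∎
      where
      D : Fin n → Carrier
      D m = if does (i ≟ m) then ∑ (allFin n) (λ k → ε k i) else 0#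
      diagonal : D i ≈ ∑ (allFin n) (λ k → ε k i)
      diagonal = reflexive (if-cong (dec-true (i ≟ i) ≡.refl))
      off-diagonal : ∀ m → m ≢ i → D m * B m j ≈ 0#
      off-diagonal m m≢i = trans
        (*-congʳ (reflexive (if-cong (dec-false (i ≟ m) (m≢i ∘ ≡.sym)))))
        (zeroˡ _)

    -- Being a subgraph of the digraph is not tested: for other vectors `w f` already vanishes.
    -- Hence `W` depends on `f` in the same way on every fibre.
    W : ℕ → Parents n → Carrier
    W k f = if does (forest? f ×-dec (count f ℕ.≟ k)) then w f else 0#

    W-zero : ∀ k f → (Forest f → count f ≢ k) → W k f ≈ 0#
    W-zero k f none = reflexive (if-cong
      (dec-false (forest? f ×-dec (count f ℕ.≟ k)) λ (F , c) → none F c))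

    unsupported⇒w≈0 : ∀ f → ¬ Supported digraph f → w f ≈ 0#
    unsupported⇒w≈0 f ¬s
      with i , ¬sᵢ ← ¬∀⟶∃¬ n _ (λ i → all? λ j → isParent? f i j →-dec arc? digraph i j) ¬s
      with j , ¬sᵢⱼ ← ¬∀⟶∃¬ n _ (λ j → isParent? f i j →-dec arc? digraph i j) ¬sᵢ = begin
        w f                         ≈⟨ ∏.∑-extract j (λ j → entry ε (lookup f j) j) ⟩
        entry ε (lookup f j) j * _  ≈⟨ *-congʳ (go (lookup f j) ¬sᵢⱼ) ⟩
        0# * _                      ≈⟨ zeroˡ _ ⟩
        0# ∎
      where
      go : ∀ {i j} x → ¬ (x ≡ just i → Arc digraph i j) → entry ε x j ≈ 0#
      go {i} nothing ¬a = contradiction (λ ()) ¬a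
      go {i} {j} (just i′) ¬a with i′ ≟ i
      ... | yes ≡.refl = ε-noArc _ _ (λ a → ¬a λ _ → a)
      ... | no i′≢i    = contradiction (λ { ≡.refl → contradiction ≡.refl i′≢i }) ¬a

    σ≈ : ∀ k → σ Γ k ≈ ∑ (allParents n) (W k)
    σ≈ k = begin
      ∑ (outForests digraph k) (weight Γ)
        ≈⟨ ∑-↭ (weight Γ) (outForests↭ digraph k) ⟩
      ∑ (map graph (filter (outForestParents? digraph k) (allParents n))) (weight Γ)
        ≡⟨ ∑-map graph (filter (outForestParents? digraph k) (allParents n)) (weight Γ) ⟩
      ∑ (filter (outForestParents? digraph k) (allParents n)) (weight Γ ∘ graph)
        ≈⟨ ∑-cong (filter (outForestParents? digraph k) (allParents n)) (Total.∑-arcs *-commutativeMonoid ε) ⟩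
      ∑ (filter (outForestParents? digraph k) (allParents n)) w
        ≈⟨ ∑-filter (outForestParents? digraph k) (allParents n) w ⟩
      ∑ (allParents n) (λ f → if does (outForestParents? digraph k f) then w f else 0#)
        ≈⟨ ∑-cong (allParents n) drop-support ⟩
      ∑ (allParents n) (W k) ∎
      where
      drop-support : ∀ f → (if does (outForestParents? digraph k f) then w f else 0#) ≈ W k f
      drop-support f = go (supported? digraph f) (forest? f ×-dec (count f ℕ.≟ k))
        where
        go : ∀ (s : Dec (Supported digraph f)) {b} {B : Set b} (d : Dec B) →
             (if does (s ×-dec d) then w f else 0#) ≈ (if does d then w f else 0#)
        go (yes _) d       = refl
        go (no ¬s) (yes _) = sym (unsupported⇒w≈0 f ¬s)
        go (no ¬s) (no _)  = refl

    Q : ℕ → Matrix n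
    Q k i j = ∑ (allParents n) λ f → W k f * ⟦ root? f i j ⟧

    Q-zero : ∀ i j → Q 0 i j ≈ σ Γ 0 * ⟦ i ≟ j ⟧
    Q-zero i j = begin
      ∑ (allParents n) (λ f → W 0 f * ⟦ root? f i j ⟧)  ≈⟨ ∑-cong (allParents n) trivial ⟩
      ∑ (allParents n) (λ f → W 0 f * ⟦ i ≟ j ⟧)        ≈⟨ ∑-* ⟦ i ≟ j ⟧ (allParents n) (W 0) ⟨
      ∑ (allParents n) (W 0) * ⟦ i ≟ j ⟧                ≈⟨ *-congʳ (σ≈ 0) ⟨
      σ Γ 0 * ⟦ i ≟ j ⟧ ∎
      where
      trivial : ∀ f → W 0 f * ⟦ root? f i j ⟧ ≈ W 0 f * ⟦ i ≟ j ⟧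
      trivial f with count f ℕ.≟ 0
      ... | yes c = *-congˡ (reflexive (if-cong
        (does-⇔ (mk⇔ (root-of-root (count-zero f c i)) (λ { ≡.refl → here (count-zero f c i) }))
          (root? f i j) (i ≟ j))))
      ... | no ¬c = trans (trans (*-congʳ W≈0) (zeroˡ _)) (sym (trans (*-congʳ W≈0) (zeroˡ _)))
        where
        W≈0 : _ ≈ 0#
        W≈0 = W-zero 0 f (λ _ → ¬c)

    -- Grafting outside the tree of `i` adds one arc and one factor. The number `k` stays free
    -- because both `W (suc k)` and `W k` of a graft are needed.
    graft-W : ∀ {h i} → lookup h i ≡ nothing → Forest h → ∀ p k → ¬ Root h p i →
              W k (h [ i ]≔ just p) ≈ ε p i * (if does (suc (count h) ℕ.≟ k) then w h else 0#)
    graft-W {h} {i} hᵢ F p k ¬ρ = begin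
      W k f
        ≡⟨ if-cong
             (does-⇔ (mk⇔ (λ (_ , c) → ≡.trans (≡.sym count-f) c)
                (λ c → graft-forest hᵢ p F ¬ρ , ≡.trans count-f c))
               (forest? f ×-dec (count f ℕ.≟ k)) (suc (count h) ℕ.≟ k)) ⟩
      (if does (suc (count h) ℕ.≟ k) then w f else 0#)
        ≈⟨ factor (does (suc (count h) ℕ.≟ k)) ⟩
      ε p i * (if does (suc (count h) ℕ.≟ k) then w h else 0#) ∎
      where
      f = h [ i ]≔ just p
      count-f : count f ≡ suc (count h)
      count-f = count-graft {h = h} hᵢ p
      factor : ∀ b → (if b then w f else 0#) ≈ ε p i * (if b then w h else 0#)
      factor true  = Total.total-graft *-commutativeMonoid ε {h} hᵢ p
      factor false = sym (zeroʳ _)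

    -- The contribution of f to the (i , j) entry of Q (k+1) + L (Q k) − σ (k+1) I.
    defect : ℕ → Fin n → Fin n → Parents n → Carrier
    defect k i j f =
      W (suc k) f * (⟦ root? f i j ⟧ - ⟦ i ≟ j ⟧) +
      W k f * ∑ (allFin n) (λ m → ε m i * (⟦ root? f i j ⟧ - ⟦ root? f m j ⟧))

    -- Cancellation of the defects of `h` and its grafts at `i`.

    module _ (k : ℕ) (i j : Fin n) where

      defect-zero : ∀ f → ¬ Forest f → defect k i j f ≈ 0#
      defect-zero f ¬F = trans
        (+-cong (trans (*-congʳ (W-zero (suc k) f (λ F → contradiction F ¬F))) (zeroˡ _))
                (trans (*-congʳ (W-zero k f (λ F → contradiction F ¬F))) (zeroˡ _)))
        (+-identityˡ 0#)

      module _ (h : Parents n) (hᵢ : lookup h i ≡ nothing) where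

        private
          f : Fin n → Parents n
          f p = h [ i ]≔ just p

          r : Fin n → Carrier
          r m = ⟦ root? h m j ⟧

          δ : Carrier
          δ = ⟦ i ≟ j ⟧

          -- The index counts the arcs of a graft, one more than `h` has; thus `V (suc k)` is the
          -- weight of `h` when `h` itself has `k` arcs.
          V : ℕ → Carrier
          V k = if does (suc (count h) ℕ.≟ k) then w h else 0#

          -- The weight of the arc from m to i if it can be added to h without closing a circuit.
          e : Fin n → Carrier
          e m = if does (root? h m i) then 0# else ε m i

          rᵢ≈δ : r i ≈ δ
          rᵢ≈δ = reflexive (if-cong
            (does-⇔ (mk⇔ (root-of-root hᵢ) (λ { ≡.refl → here hᵢ })) (root? h i j) (i ≟ j)))

          below≈δ : ∀ {m} → Root h m i → r m ≈ δ
          below≈δ ρ = trans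
            (reflexive (if-cong (same-root ρ (here hᵢ) j))) rᵢ≈δ

        module _ (F : Forest h) where

          private
            W≈V : W k h ≈ V (suc k)
            W≈V = reflexive (if-cong
              (does-⇔ (mk⇔ (λ (_ , c) → ≡.cong suc c) (λ c → F , ℕ.suc-injective c))
                (forest? h ×-dec (count h ℕ.≟ k)) (suc (count h) ℕ.≟ suc k)))

            -- The first summand vanishes because `i` is its own root. In the second, every `m` in
            -- the tree of `i` gives a zero difference, so `ε m i` may be replaced by `e m`.
            defect-root : defect k i j h ≈ V (suc k) * ∑ (allFin n) (λ m → e m * (δ - r m))
            defect-root = trans
              (+-cong
                (trans (*-congˡ (x≈y⇒x∙y⁻¹≈ε rᵢ≈δ)) (zeroʳ _))
                (*-cong W≈V (∑-cong (allFin n) term)))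
              (+-identityˡ _)
              where
              term : ∀ m → ε m i * (r i - r m) ≈ e m * (δ - r m)
              term m with root? h m i
              ... | no _  = *-congˡ (+-congʳ rᵢ≈δ)
              ... | yes ρ = trans (*-congˡ (x≈y⇒x∙y⁻¹≈ε (trans rᵢ≈δ (sym (below≈δ ρ)))))
                (trans (zeroʳ _) (sym (zeroˡ _)))

            -- In the graft, the whole tree of `i` takes over the root of `p`, and all other
            -- vertices keep theirs. So `i` is seen as `r p`, and again only the `m` outside its
            -- tree contribute.
            defect-graft : ∀ p → defect k i j (f p) ≈
              V (suc k) * (e p * (r p - δ)) +
              V k * (e p * ∑ (allFin n) (λ m → e m * (r p - r m)))
            defect-graft p with root? h p i
            -- If `p` lies in the tree of `i`, the left side is 0 since a circuit arises, the right
            -- side since `e p` is 0.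
            ... | yes ρ = trans (defect-zero (f p) (graft-cyclic hᵢ p ρ))
              (sym (trans (+-cong (trans (*-congˡ (zeroˡ _)) (zeroʳ _)) (trans (*-congˡ (zeroˡ _)) (zeroʳ _)))
                (+-identityˡ 0#)))
            ... | no ¬ρ with s , τ ← F p = +-cong
              (trans (*-cong (graft-W hᵢ F p (suc k) ¬ρ) (+-congʳ (below (here hᵢ))))
                (rearrange (V (suc k))))
              (trans (*-cong (graft-W hᵢ F p k ¬ρ) (∑-cong (allFin n) term)) (rearrange (V k)))
              where
              s≢i : s ≢ i
              s≢i ≡.refl = ¬ρ τ
              rearrange : ∀ v {x} → ε p i * v * x ≈ v * (ε p i * x)
              rearrange v = trans (*-congʳ (*-comm _ _)) (*-assoc _ _ _)
              below : ∀ {m} → Root h m i → ⟦ root? (f p) m j ⟧ ≈ r p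
              below σ = reflexive (if-cong
                (same-root (graft-below hᵢ p σ τ s≢i) τ j))
              other : ∀ {m} → ¬ Root h m i → ⟦ root? (f p) m j ⟧ ≈ r m
              other {m} ¬σ with t , σ ← F m = reflexive (if-cong
                (same-root (graft-other hᵢ p σ (λ { ≡.refl → ¬σ σ })) σ j))
              term : ∀ m → ε m i * (⟦ root? (f p) i j ⟧ - ⟦ root? (f p) m j ⟧) ≈ e m * (r p - r m)
              term m with root? h m i
              ... | no ¬σ = *-congˡ (+-cong (below (here hᵢ)) (-‿cong (other ¬σ)))
              ... | yes σ = trans (*-congˡ (x≈y⇒x∙y⁻¹≈ε (trans (below (here hᵢ)) (sym (below σ)))))
                (trans (zeroʳ _) (sym (zeroˡ _)))

          -- The terms linear in `e` cancel between `h` and its grafts, the quadratic ones among the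
          -- grafts.
          defect-cancel-forest : defect k i j h + ∑ (allFin n) (λ p → defect k i j (f p)) ≈ 0#
          defect-cancel-forest = begin
            defect k i j h + ∑ (allFin n) (λ p → defect k i j (f p))
              ≈⟨ +-cong defect-root (trans (∑-cong (allFin n) defect-graft) (∑-∙ (allFin n) _ _)) ⟩
            V (suc k) * ∑ (allFin n) (λ m → e m * (δ - r m)) +
              (∑ (allFin n) (λ p → V (suc k) * (e p * (r p - δ))) +
               ∑ (allFin n) (λ p → V k * (e p * ∑ (allFin n) (λ m → e m * (r p - r m)))))
              ≈⟨ +-congˡ (+-cong (sym (*-∑ (V (suc k)) (allFin n) _))
                   (trans (sym (*-∑ (V k) (allFin n) _))
                     (trans (*-congˡ (∑∑-antisym (allFin n) e r)) (zeroʳ _)))) ⟩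
            V (suc k) * ∑ (allFin n) (λ m → e m * (δ - r m)) +
              (V (suc k) * ∑ (allFin n) (λ p → e p * (r p - δ)) + 0#)
              ≈⟨ +-congˡ (+-identityʳ _) ⟩
            V (suc k) * ∑ (allFin n) (λ m → e m * (δ - r m)) +
              V (suc k) * ∑ (allFin n) (λ p → e p * (r p - δ))
              ≈⟨ distribˡ _ _ _ ⟨
            V (suc k) * (∑ (allFin n) (λ m → e m * (δ - r m)) + ∑ (allFin n) (λ p → e p * (r p - δ)))
              ≈⟨ *-congˡ (∑-∙ (allFin n) _ _) ⟨
            V (suc k) * ∑ (allFin n) (λ m → e m * (δ - r m) + e m * (r m - δ))
              ≈⟨ *-congˡ (∑-zero (allFin n) (λ m → trans (sym (distribˡ _ _ _))
                   (trans (*-congˡ (sub-antisym δ (r m))) (zeroʳ _)))) ⟩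
            V (suc k) * 0#
              ≈⟨ zeroʳ _ ⟩
            0# ∎

        -- If `h` is not a forest, neither is any graft, since pruning would recover `h`; then all
        -- defects are 0.
        defect-cancel : defect k i j h + ∑ (allFin n) (λ p → defect k i j (f p)) ≈ 0#
        defect-cancel with forest? h
        ... | yes F = defect-cancel-forest F
        ... | no ¬F = trans
          (+-cong (defect-zero h ¬F)
            (∑-zero (allFin n) (λ p → defect-zero (f p) (λ F → ¬F (prune-forest hᵢ p F)))))
          (+-identityˡ 0#)

  ∑-defect : ∀ {n} (Γ : WeightedDigraph n) k i j → ∑ (allParents n) (defect Γ k i j) ≈ 0#
  ∑-defect {suc n} Γ k i j = trans
    (∑-allVecs (maybes (suc n)) i (defect Γ k i j))
    (∑-zero (allVecs (maybes (suc n)) n) cancel)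
    where
    cancel : ∀ v → ∑ (maybes (suc n)) (λ x → defect Γ k i j (insertAt v i x)) ≈ 0#
    -- `maybes` lists `nothing` first, so the head of the sum is the defect of `h` and the tail runs
    -- over its grafts.
    cancel v = trans
      (+-congˡ (trans (reflexive (∑-map just (allFin (suc n)) (λ x → defect Γ k i j (insertAt v i x))))
        (∑-cong (allFin (suc n)) (λ p →
          reflexive (≡.cong (defect Γ k i j) (insertAt-just v i nothing (just p)))))))
      (defect-cancel Γ k i j (insertAt v i nothing) (insertAt-lookup v i nothing))

  -- The recurrence and the annihilating polynomial.

  module _ {n : ℕ} (Γ : WeightedDigraph n) where
    open WeightedDigraph Γ
    private
      L = kirchhoff Γ

    recurrence : ∀ k i j → (L *ₘ Q Γ k) i j ≈ σ Γ (suc k) * ⟦ i ≟ j ⟧ - Q Γ (suc k) i j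
    recurrence k i j = x∙y⁻¹≈ε⇒x≈y _ _ (begin
      (L *ₘ Q Γ k) i j - (σ Γ (suc k) * ⟦ i ≟ j ⟧ - Q Γ (suc k) i j)
        ≈⟨ +-congˡ (⁻¹-anti-homo‿- _ _) ⟩
      (L *ₘ Q Γ k) i j + (Q Γ (suc k) i j - σ Γ (suc k) * ⟦ i ≟ j ⟧)
        ≈⟨ +-comm _ _ ⟩
      (Q Γ (suc k) i j - σ Γ (suc k) * ⟦ i ≟ j ⟧) + (L *ₘ Q Γ k) i j
        ≈⟨ +-cong left right ⟩
      ∑ Fs (λ f → W Γ (suc k) f * (⟦ root? f i j ⟧ - ⟦ i ≟ j ⟧)) +
      ∑ Fs (λ f → W Γ k f * ∑ (allFin n) (λ m → ε m i * (⟦ root? f i j ⟧ - ⟦ root? f m j ⟧)))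
        ≈⟨ ∑-∙ Fs _ _ ⟨
      ∑ Fs (defect Γ k i j)
        ≈⟨ ∑-defect Γ k i j ⟩
      0# ∎)
      where
      Fs = allParents n
      left : Q Γ (suc k) i j - σ Γ (suc k) * ⟦ i ≟ j ⟧ ≈
             ∑ Fs (λ f → W Γ (suc k) f * (⟦ root? f i j ⟧ - ⟦ i ≟ j ⟧))
      left = sym (trans (∑-cong Fs (λ f → *-sub _ _ _)) (trans (∑-sub Fs _ _)
        (+-congˡ (-‿cong (trans (sym (∑-* ⟦ i ≟ j ⟧ Fs _)) (*-congʳ (sym (σ≈ Γ (suc k)))))))))
      term : ∀ m → ε m i * (Q Γ k i j - Q Γ k m j) ≈
             ∑ Fs (λ f → W Γ k f * (ε m i * (⟦ root? f i j ⟧ - ⟦ root? f m j ⟧)))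
      term m = trans (*-congˡ (sym (∑-sub Fs _ _))) (trans (*-∑ (ε m i) Fs _)
        (∑-cong Fs (λ f → trans (*-congˡ (sym (*-sub _ _ _))) (x∙yz≈y∙xz _ _ _))))
      right : (L *ₘ Q Γ k) i j ≈
              ∑ Fs (λ f → W Γ k f * ∑ (allFin n) (λ m → ε m i * (⟦ root? f i j ⟧ - ⟦ root? f m j ⟧)))
      right = trans (kirchhoff-product Γ (Q Γ k) i j) (trans (∑-cong (allFin n) term)
        (trans (∑-comm (allFin n) Fs _) (∑-cong Fs (λ f → sym (*-∑ (W Γ k f) (allFin n) _)))))

    private
      -- The cofactor of `λ` in `p′`, with `k` in place of `n − v` to allow induction.
      P : ℕ → Polynomial
      P k = ∑ₚ (upTo (suc k)) (λ i → σ Γ (k ℕ.∸ i) ·ₚ ((-ₚ indeterminate) ^ₚ i))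

      shifted : ℕ → Polynomial
      shifted k = ∑ₚ (upTo (suc k))
        (λ i → σ Γ (k ℕ.∸ i) ·ₚ ((-ₚ indeterminate) *ₚ ((-ₚ indeterminate) ^ₚ i)))

      -- Split off the summand of index 0 and shift the others: `suc k ∸ suc i` and the power with
      -- exponent `suc i` reduce by computation to the terms of `shifted`.
      P-suc : ∀ k → P (suc k) ≡ σ Γ (suc k) ·ₚ (1# ∷ []) +ₚ shifted k
      P-suc k = ≡.cong (λ xs → σ Γ (suc k) ·ₚ (1# ∷ []) +ₚ List.foldr _+ₚ_ [] xs)
        (≡.trans (≡.cong (map term) (≡.sym (map-upTo suc (suc k)))) (≡.sym (map-∘ (upTo (suc k)))))
        where
        term : ℕ → Polynomial
        term i = σ Γ (suc k ℕ.∸ i) ·ₚ ((-ₚ indeterminate) ^ₚ i)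

    -- The Horner step, `P (k+1)` being `σ (k+1) − λ P k`, is the recurrence solved for `Q (k+1)`.
    evaluate-P : ∀ k → evaluate (P k) L ≈ₘ Q Γ k
    evaluate-P zero i j = begin
      evaluate (σ Γ 0 * 1# ∷ []) L i j  ≈⟨ evaluate-constant L _ i j ⟩
      σ Γ 0 * 1# * ⟦ i ≟ j ⟧            ≈⟨ *-congʳ (*-identityʳ _) ⟩
      σ Γ 0 * ⟦ i ≟ j ⟧                 ≈⟨ Q-zero Γ i j ⟨
      Q Γ 0 i j ∎
    evaluate-P (suc k) i j = begin
      evaluate (P (suc k)) L i j
        ≡⟨ ≡.cong (λ q → evaluate q L i j) (P-suc k) ⟩
      evaluate (σ Γ (suc k) ·ₚ (1# ∷ []) +ₚ shifted k) L i j
        ≈⟨ evaluate-+ L (σ Γ (suc k) ·ₚ (1# ∷ [])) (shifted k) i j ⟩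
      evaluate (σ Γ (suc k) * 1# ∷ []) L i j + evaluate (shifted k) L i j
        ≈⟨ +-cong (trans (evaluate-constant L _ i j) (*-congʳ (*-identityʳ _)))
             (evaluate-∑-λ* L (upTo (suc k)) (λ i → σ Γ (k ℕ.∸ i)) (λ i → (-ₚ indeterminate) ^ₚ i) i j) ⟩
      σ Γ (suc k) * ⟦ i ≟ j ⟧ - (L *ₘ evaluate (P k) L) i j
        ≈⟨ +-congˡ (-‿cong (trans (*ₘ-congˡ L (evaluate-P k) i j) (recurrence k i j))) ⟩
      σ Γ (suc k) * ⟦ i ≟ j ⟧ - (σ Γ (suc k) * ⟦ i ≟ j ⟧ - Q Γ (suc k) i j)
        ≈⟨ +-congˡ (⁻¹-anti-homo‿- _ _) ⟩
      σ Γ (suc k) * ⟦ i ≟ j ⟧ + (Q Γ (suc k) i j - σ Γ (suc k) * ⟦ i ≟ j ⟧)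
        ≈⟨ +-assoc _ _ _ ⟨
      σ Γ (suc k) * ⟦ i ≟ j ⟧ + Q Γ (suc k) i j - σ Γ (suc k) * ⟦ i ≟ j ⟧
        ≈⟨ xyx⁻¹≈y _ _ ⟩
      Q Γ (suc k) i j ∎

    annihilates : ∀ v → IsOutForestDimension digraph v → Annihilates (p′ Γ v) L
    annihilates v dim i j = begin
      evaluate (indeterminate *ₚ P (n ℕ.∸ v)) L i j
        ≈⟨ evaluate-λ* L (P (n ℕ.∸ v)) i j ⟩
      (L *ₘ evaluate (P (n ℕ.∸ v)) L) i j
        ≈⟨ *ₘ-congˡ L (evaluate-P (n ℕ.∸ v)) i j ⟩
      (L *ₘ Q Γ (n ℕ.∸ v)) i j
        ≈⟨ recurrence (n ℕ.∸ v) i j ⟩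
      σ Γ (suc (n ℕ.∸ v)) * ⟦ i ≟ j ⟧ - Q Γ (suc (n ℕ.∸ v)) i j
        ≈⟨ +-cong
             (trans (*-congʳ (trans (σ≈ Γ _) (∑-zero (allParents n) vanish))) (zeroˡ _))
             (-‿cong (∑-zero (allParents n) (λ f → trans (*-congʳ (vanish f)) (zeroˡ _)))) ⟩
      0# - 0#
        ≈⟨ -‿inverseʳ 0# ⟩
      0# ∎
      where
      -- A supported vector cannot be a forest with this many arcs, by minimality of `v`; an
      -- unsupported one has weight 0.
      vanish : ∀ f → W Γ (suc (n ℕ.∸ v)) f ≈ 0#
      vanish f with supported? digraph f
      ... | yes s = W-zero Γ _ f (no-larger-forest dim s)
      ... | no ¬s = if-zero (does (forest? f ×-dec (count f ℕ.≟ suc (n ℕ.∸ v))))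
        where
        if-zero : ∀ b → (if b then w Γ f else 0#) ≈ 0#
        if-zero true  = unsupported⇒w≈0 Γ f ¬s
        if-zero false = refl

open Defs using (WeightedDigraph; module WeightedDigraph; Annihilates; p′; kirchhoff)

proposition10 : (n : ℕ) → 1 < n → (Γ : WeightedDigraph n) → (v : ℕ) →
    IsOutForestDimension (WeightedDigraph.digraph Γ) v →
    Annihilates (p′ Γ v) (kirchhoff Γ)
proposition10 n _ Γ v = Annihilation.annihilates Defs.ℝ-commutativeRing Defs.Positiveℝ Γ v
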